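{- Let $n\ge 2$ and let $\mu=(\mu_1\ge\mu_2\ge\dots\ge\mu_{n-1}\ge\mu_n=0)$ be a partition (a dominant weight of type $A_{n-1}$), with conjugate partition $\mu'$. Let $\overline{\mathcal F}(\mu)$, the filling map $f$, the map $\mathrm{ord}$ and the set $B_\mu$ be as defined in the context. Then the composite map $\mathrm{ord}\circ f$ is a bijection from $\overline{\mathcal F}(\mu)$ onto $B_\mu$.
   Context: Permutations $w\in S_n$ are written in one-line notation $w=w(1)\dots w(n)$; $\ell(w)$ is the number of inversions and $<$ denotes Bruhat order. For $1\le i<j\le n$, $(i,j)$ denotes both the positive root $\varepsilon_i-\varepsilon_j$ of type $A_{n-1}$ and the transposition $t_{ij}$; $w(i,j)$ is $w$ with the entries in positions $i$ and $j$ swapped. For $1\le k\le n-1$ let $\Gamma(k)$ be the sequence of roots $((1,n),(1,n-1),\dots,(1,k+1),(2,n),(2,n-1),\dots,(2,k+1),\dots,(k,n),(k,n-1),\dots,(k,k+1))$. Let $\Gamma=\Gamma^{\mu_1}\Gamma^{\mu_1-1}\cdots\Gamma^1=(\beta_1,\dots,\beta_m)$ be the concatenation with $\Gamma^j=\Gamma(\mu'_j)$. A folding pair is $(w,J)$ with $w\in S_n$ and $J=\{j_1<\dots<j_s\}\subseteq\{1,\dots,m\}$; set $w_0=w$, $w_i=w\beta_{j_1}\cdots\beta_{j_i}$ (product of transpositions), $\mathrm{end}(w,J)=w_s$. The element $j_i$ is a negative folding if $w_{i-1}<w_i$ (and positive if $w_{i-1}>w_i$); $J^-$ is the set of negative foldings.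 For $\beta_j=(a,b)$ put $\langle\rho,\beta_j^\vee\rangle=b-a$. Then $\overline{\mathcal F}(\mu)$ is the set of folding pairs with $\frac12(\ell(w)+\ell(\mathrm{end}(w,J))-\#J)+\sum_{j\in J^- }\langle\rho,\beta_j^\vee\rangle=0$. We identify $J$ with the subsequence $T$ of $\Gamma$ at the positions in $J$, factored as $T=T^{\mu_1}\cdots T^1$ with $T^j$ the part lying in $\Gamma^j$. For $j=0,\dots,\mu_1$ let $\pi^j=wT^{\mu_1}T^{\mu_1-1}\cdots T^{j+1}$ (right multiplication by the transpositions, read left to right). The filling map sends $(w,T)$ to the filling $f(w,T)=C^{\mu_1}\cdots C^1$ of the Young diagram of $\mu$, where the column $C^j$ (of height $\mu'_j$) is $C^j=\pi^j(1)\pi^j(2)\cdots\pi^j(\mu'_j)$ read top to bottom, and columns are displayed left to right as $C^{\mu_1},\dots,C^1$ (shortest to longest, top-justified). The map $\mathrm{ord}$ sorts each column increasingly from top to bottom. $B_\mu$ is the set of fillings of the Young diagram of $\mu$ with entries in $\{1,\dots,n\}$ that are strictly increasing down each column (no condition on rows). -}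

module Defs where

open import Data.Nat as ℕ using (ℕ; zero; suc; _+_; _*_; _∸_; _≤_; _<_; _≤?_; _<?_)
open import Data.Fin as Fin using (Fin; toℕ)
open import Data.Fin.Properties using (≤-decTotalOrder)
open import Data.Vec as Vec using (Vec; lookup; _[_]≔_; toList)
open import Data.List as List using (List; []; _∷_; map; filter; concat; concatMap; reverse; length; take; drop; downFrom; allFin; cartesianProduct)
open import Data.Bool using (Bool; true; false)
open import Data.Product using (_×_; _,_; proj₁; proj₂; ∃; ∃₂)
open import Relation.Nullary.Decidable using (_×-dec_)
open import Data.List.Relation.Unary.All using (All)
open import Data.List.Relation.Unary.Linked using (Linked)
open import Relation.Binary.Construct.Closure.Transitive using (TransClosure)
open import Relation.Binary.PropositionalEquality using (_≡_)
import Data.List.Sort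

-- Conventions: positions and values 1..n of the paper are encoded by Fin n
-- (0-based): paper index i  ↔  Fin element with toℕ = i - 1.

Perm : ℕ → Set
Perm n = Vec (Fin n) n

-- w is a permutation (injective, hence bijective on Fin n)
IsPerm : ∀ {n} → Perm n → Set
IsPerm w = ∀ i j → lookup w i ≡ lookup w j → i ≡ j

inversions : ∀ {n} → Perm n → List (Fin n × Fin n)
inversions {n} w =
  filter (λ p → (proj₁ p Fin.<? proj₂ p) ×-dec (lookup w (proj₂ p) Fin.<? lookup w (proj₁ p)))
         (cartesianProduct (allFin n) (allFin n))

ℓ : ∀ {n} → Perm n → ℕ
ℓ w = length (inversions w)

-- w(a,b): swap the entries in positions a and b (right multiplication by t_ab)
swap : ∀ {n} → Perm n → Fin n → Fin n → Perm n
swap w a b = (w [ a ]≔ lookup w b) [ b ]≔ lookup w a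

BruhatStep : ∀ {n} → Perm n → Perm n → Set
BruhatStep {n} u v = ∃₂ λ (a b : Fin n) → (a Fin.< b) × (v ≡ swap u a b) × (ℓ u < ℓ v)

_<B_ : ∀ {n} → Perm n → Perm n → Set
_<B_ = TransClosure BruhatStep

first : ∀ {n} → Vec ℕ n → ℕ
first Vec.[] = 0
first (x Vec.∷ _) = x

IsPartition : ∀ {n} → Vec ℕ n → Set
IsPartition {n} μ =
  (∀ (i j : Fin n) → i Fin.≤ j → lookup μ j ≤ lookup μ i)
  × (∀ (i : Fin n) → suc (toℕ i) ≡ n → lookup μ i ≡ 0)

conj : ∀ {n} → Vec ℕ n → ℕ → ℕ
conj μ j = length (filter (λ x → j ≤? x) (toList μ))

-- column heights in display order: μ'_{μ1}, …, μ'_1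
shape : ∀ {n} → Vec ℕ n → List ℕ
shape μ = map (λ j → conj μ (suc j)) (downFrom (first μ))

Root : ℕ → Set
Root n = Fin n × Fin n

Γk : ∀ {n} → ℕ → List (Root n)
Γk {n} k =
  concatMap (λ a → map (λ b → (a , b)) (filter (λ b → k ≤? toℕ b) (reverse (allFin n))))
            (filter (λ a → toℕ a <? k) (allFin n))

blocks : ∀ {n} → Vec ℕ n → List (ℕ × List (Root n))
blocks μ = map (λ h → (h , Γk h)) (shape μ)

Γ : ∀ {n} → Vec ℕ n → List (Root n)
Γ μ = concat (map proj₂ (blocks μ))

-- ⟨ρ, β^∨⟩ = b - a
ρβ : ∀ {n} → Root n → ℕ
ρβ (a , b) = toℕ b ∸ toℕ a

-- Folding pairs.  J ⊆ {1..m} is given by its characteristic list of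
-- Booleans along Γ (length m).

count : List Bool → ℕ
count [] = 0
count (true ∷ J) = suc (count J)
count (false ∷ J) = count J

-- FoldRun w βs J w' s : running the foldings J along βs starting at w ends
-- at w' = end(w,J), and s is the sum of ⟨ρ,β_j^∨⟩ over negative foldings.
data FoldRun {n} : Perm n → List (Root n) → List Bool → Perm n → ℕ → Set where
  done : ∀ {w} → FoldRun w [] [] w 0
  skip : ∀ {w β βs J w' s} → FoldRun w βs J w' s → FoldRun w (β ∷ βs) (false ∷ J) w' s
  neg  : ∀ {w a b βs J w' s} → w <B swap w a b → FoldRun (swap w a b) βs J w' s →
         FoldRun w ((a , b) ∷ βs) (true ∷ J) w' (ρβ (a , b) + s)
  pos  : ∀ {w a b βs J w' s} → swap w a b <B w → FoldRun (swap w a b) βs J w' s →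
         FoldRun w ((a , b) ∷ βs) (true ∷ J) w' s

-- (w,J) ∈ F̄(μ):  ½(ℓ(w)+ℓ(end)-#J) + Σ_{J⁻} ⟨ρ,β^∨⟩ = 0, cleared of the ½.
InFbar : ∀ {n} → Vec ℕ n → Perm n → List Bool → Set
InFbar μ w J =
  IsPerm w × (length J ≡ length (Γ μ)) ×
  ∃₂ λ w' s → FoldRun w (Γ μ) J w' s × (ℓ w + ℓ w' + 2 * s ≡ count J)

applyT : ∀ {n} → Perm n → List (Root n) → List Bool → Perm n
applyT π [] _ = π
applyT π (_ ∷ _) [] = π
applyT π ((a , b) ∷ βs) (true ∷ J) = applyT (swap π a b) βs J
applyT π (_ ∷ βs) (false ∷ J) = applyT π βs J

fillBlocks : ∀ {n} → Perm n → List (ℕ × List (Root n)) → List Bool → List (List (Fin n))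
fillBlocks π [] J = []
fillBlocks π ((h , blk) ∷ rest) J =
  take h (toList π) ∷ fillBlocks (applyT π blk (take (length blk) J)) rest (drop (length blk) J)

fill : ∀ {n} → Vec ℕ n → Perm n → List Bool → List (List (Fin n))
fill μ w J = fillBlocks w (blocks μ) J

ord : ∀ {n} → List (List (Fin n)) → List (List (Fin n))
ord {n} = map (Data.List.Sort.sort (≤-decTotalOrder n))

InB : ∀ {n} → Vec ℕ n → List (List (Fin n)) → Set
InB {n} μ F = (map length F ≡ shape μ) × All (Linked (Fin._<_ {n})) F

{-# OPTIONS --safe #-}
module Submission where

-- Swapping positions a < b with w(a) < w(b) raises the length by 1 + 2N, where N counts the
-- positions i between a and b with w(a) < w(i) < w(b), and 0 ≤ N ≤ b - a - 1.  Hence the left-hand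
-- side of the equation defining F̄(μ), doubled, is 2ℓ(end) plus a nonnegative defect for every folding,
-- and it vanishes iff end = id and every folding reverses an edge of the quantum Bruhat graph.
-- In terms of the cyclic order on values, an edge at (a,b) just says that no entry at a
-- position between a and b lies on the arc between the two swapped entries.
--
-- Reading Γ backwards from id, it remains to see that in each block Γ(k), for a permutation u and a
-- k-set S, a unique edge path from u leads to some w with w{1..k} = S.  In row a the entry u(a) can be
-- replaced, in a unique way, by any v from {u(a), u(k+1), ..., u(n)} such that no entry in the rows
-- a+1..k lies on the arc from u(a) to v.  So w(1) is the first element of S met going up cyclically
-- from u(1), w(2) the first element of the remaining set met from u(2), and so on.

open import Defs
open import Data.Nat as ℕ using (ℕ; zero; suc; _+_; _*_; _∸_; _⊓_; _≤_; _<_; z≤n; s≤s; _<?_; _≤?_)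
import Data.Nat.Properties as ℕ
open import Data.Nat.Solver using (module +-*-Solver)
open import Data.Fin as Fin using (Fin; zero; suc; toℕ)
import Data.Fin.Properties as Fin
open import Data.Vec as Vec using (Vec; lookup; toList)
import Data.Vec.Properties as Vec
open import Data.List as List using (List; []; _∷_; _++_; map; length; concat; concatMap; filter; reverse; allFin; tabulate; take; drop; downFrom; cartesianProduct)
import Data.List.Properties as List
open import Data.List.Relation.Unary.All as All using (All; []; _∷_)
import Data.List.Relation.Unary.All.Properties as All
open import Data.List.Relation.Unary.Any using (here; there)
import Data.List.Relation.Unary.Any.Properties as Any
open import Data.List.Relation.Unary.AllPairs as AllPairs using (AllPairs; []; _∷_)
import Data.List.Relation.Unary.AllPairs.Properties as AllPairs
open import Data.List.Relation.Unary.Linked as Linked using (Linked)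
import Data.List.Relation.Unary.Linked.Properties as Linked
open import Data.List.Relation.Unary.Unique.Propositional using (Unique)
import Data.List.Relation.Unary.Unique.Propositional.Properties as Unique
open import Data.List.Relation.Unary.Sorted.TotalOrder.Properties using (↗↭↗⇒≋; Sorted⇒AllPairs)
open import Data.List.Relation.Binary.Pointwise using (Pointwise-≡⇒≡)
open import Data.List.Membership.Propositional using (_∈_; _∉_)
open import Data.List.Membership.Propositional.Properties using (∈-map⁺; ∈-map⁻; ∈-filter⁺; ∈-allFin)
open import Data.List.Relation.Binary.Permutation.Propositional as ↭ using (_↭_; ↭-refl; ↭-sym; ↭-trans; ↭-reflexive; prep; ↭⇒↭ₛ)
open import Data.List.Relation.Binary.Permutation.Propositional.Properties using (∈-resp-↭; ↭-length; drop-∷)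
import Data.List.Relation.Binary.Permutation.Setoid.Properties as ↭ₛ
import Data.List.Sort
open import Data.Bool using (Bool; true; false; _∧_)
open import Data.Product using (_×_; _,_; proj₁; proj₂; ∃; ∃₂)
open import Data.Sum using (_⊎_; inj₁; inj₂)
open import Data.Empty using (⊥; ⊥-elim)
open import Level using (0ℓ)
open import Function using (_∘_; id)
open import Relation.Nullary using (¬_; Dec; yes; no; does)
open import Relation.Nullary.Decidable using (dec-true; dec-false; _×-dec_; _⊎-dec_)
open import Relation.Unary using (Pred; Decidable)
open import Relation.Binary.Bundles using (DecTotalOrder)
open import Relation.Binary.Construct.Closure.Transitive using ([_]) renaming (_∷_ to _∷⁺_)
open import Relation.Binary.Definitions using (tri<; tri≈; tri>)
open import Relation.Binary.PropositionalEquality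
open import Algebra.Properties.CommutativeMonoid.Sum ℕ.+-0-commutativeMonoid using (sum; sum-cong-≗; ∑-distrib-+)

private
  variable
    n : ℕ
    A : Set

-- The length of a permutation and transpositions

bit : Bool → ℕ
bit true  = 1
bit false = 0

bit-∧ : ∀ x y → bit (x ∧ y) ≡ bit x * bit y
bit-∧ true  y = sym (ℕ.+-identityʳ _)
bit-∧ false y = refl

lt : ℕ → ℕ → ℕ
lt i j = bit (does (i <? j))

lt-yes : ∀ {i j} → i < j → lt i j ≡ 1
lt-yes {i} {j} i<j = cong bit (dec-true (i <? j) i<j)

lt-no : ∀ {i j} → j ≤ i → lt i j ≡ 0
lt-no {i} {j} j≤i = cong bit (dec-false (i <? j) (ℕ.≤⇒≯ j≤i))

∑-cong : {f g : Fin n → ℕ} → (∀ i → f i ≡ g i) → sum f ≡ sum g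
∑-cong eq = sum-cong-≗ eq

sum≡0⇒≡0 : (f : Fin n → ℕ) → sum f ≡ 0 → ∀ i → f i ≡ 0
sum≡0⇒≡0 f eq zero    = ℕ.m+n≡0⇒m≡0 _ eq
sum≡0⇒≡0 f eq (suc i) = sum≡0⇒≡0 (f ∘ suc) (ℕ.m+n≡0⇒n≡0 (f zero) eq) i

≡0⇒sum≡0 : (f : Fin n → ℕ) → (∀ i → f i ≡ 0) → sum f ≡ 0
≡0⇒sum≡0 {zero}  f eq = refl
≡0⇒sum≡0 {suc n} f eq = cong₂ _+_ (eq zero) (≡0⇒sum≡0 (f ∘ suc) (eq ∘ suc))

δ : Fin n → Fin n → ℕ
δ a i = bit (does (i Fin.≟ a))

δ-≢ : ∀ {a i : Fin n} → i ≢ a → δ a i ≡ 0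
δ-≢ {a = a} {i} i≢a = cong bit (dec-false (i Fin.≟ a) i≢a)

sum-δ : (a : Fin n) (f : Fin n → ℕ) → sum (λ i → δ a i * f i) ≡ f a
sum-δ zero    f = trans (cong₂ _+_ (ℕ.+-identityʳ (f zero)) (≡0⇒sum≡0 (λ i → δ zero (suc i) * f (suc i)) (λ _ → refl))) (ℕ.+-identityʳ _)
sum-δ (suc a) f = sum-δ a (f ∘ suc)

-- Indicator of the positions other than `a` and `b`, kept numeric so that it can weight a sum;
-- truncated subtraction keeps it at 0 when `a`, `b` and `i` all coincide.
off : Fin n → Fin n → Fin n → ℕ
off a b i = 1 ∸ (δ a i + δ b i)

off-cases : ∀ (a b i : Fin n) → (i ≡ a ⊎ i ≡ b) × off a b i ≡ 0 ⊎ i ≢ a × i ≢ b × off a b i ≡ 1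
off-cases a b i with i Fin.≟ a | i Fin.≟ b
... | yes i≡a | b?     = inj₁ (inj₁ i≡a , ℕ.0∸n≡0 (bit (does b?)))
... | no  _   | yes i≡b = inj₁ (inj₂ i≡b , refl)
... | no  i≢a | no i≢b  = inj₂ (i≢a , i≢b , refl)

module _ {a b : Fin n} (a≢b : a ≢ b) where

  decompose : ∀ (f : Fin n → ℕ) i → f i ≡ δ a i * f i + δ b i * f i + off a b i * f i
  decompose f i with i Fin.≟ a
  ... | yes refl rewrite δ-≢ a≢b | ℕ.+-identityʳ (f i) | ℕ.+-identityʳ (f i) | ℕ.+-identityʳ (f i) = refl
  ... | no i≢a with i Fin.≟ b
  ...   | yes refl rewrite ℕ.+-identityʳ (f i) | ℕ.+-identityʳ (f i) = refl
  ...   | no i≢b = sym (ℕ.+-identityʳ _)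

  sum-split : (f : Fin n → ℕ) → sum f ≡ f a + f b + sum (λ i → off a b i * f i)
  sum-split f = begin
    sum f                                                                       ≡⟨ ∑-cong (decompose f) ⟩
    sum (λ i → δ a i * f i + δ b i * f i + off a b i * f i)                     ≡⟨ ∑-distrib-+ (λ i → δ a i * f i + δ b i * f i) _ ⟩
    sum (λ i → δ a i * f i + δ b i * f i) + sum (λ i → off a b i * f i)         ≡⟨ cong (_+ sum (λ i → off a b i * f i)) (∑-distrib-+ (λ i → δ a i * f i) _) ⟩
    sum (λ i → δ a i * f i) + sum (λ i → δ b i * f i) + sum (λ i → off a b i * f i)
      ≡⟨ cong (_+ sum (λ i → off a b i * f i)) (cong₂ _+_ (sum-δ a f) (sum-δ b f)) ⟩
    f a + f b + sum (λ i → off a b i * f i)                                     ∎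
    where open ≡-Reasoning

  -- Pairs of positions are grouped by how many members they have in {a, b}: the corner terms, the
  -- terms with exactly one such member, and the rest. A swap at `a` and `b` acts differently on the
  -- three groups.
  sum²-split : (F : Fin n → Fin n → ℕ) →
    sum (λ i → sum (F i)) ≡
      (F a a + F a b + F b a + F b b)
      + (sum (λ i → off a b i * (F a i + F b i + F i a + F i b))
      + sum (λ i → off a b i * sum (λ j → off a b j * F i j)))
  sum²-split F = begin
    sum (λ i → sum (F i))
      ≡⟨ sum-split (λ i → sum (F i)) ⟩
    sum (F a) + sum (F b) + sum (λ i → o i * sum (F i))
      ≡⟨ cong₂ _+_ (cong₂ _+_ (sum-split (F a)) (sum-split (F b)))
           (trans (∑-cong (λ i → trans (cong (o i *_) (sum-split (F i))) (ℕ.*-distribˡ-+ (o i) _ _)))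
                  (∑-distrib-+ (λ i → o i * (F i a + F i b)) _)) ⟩
    (F a a + F a b + Ra) + (F b a + F b b + Rb) + (C + R)
      ≡⟨ solve 8 (λ p q r s t u v w → (p :+ q :+ t) :+ (r :+ s :+ u) :+ (v :+ w) :=
                                      (p :+ q :+ r :+ s) :+ (((t :+ u) :+ v) :+ w))
           refl (F a a) (F a b) (F b a) (F b b) Ra Rb C R ⟩
    (F a a + F a b + F b a + F b b) + (Ra + Rb + C + R)
      ≡⟨ cong (λ z → (F a a + F a b + F b a + F b b) + (z + R)) cross ⟩
    _ ∎
    where
    open ≡-Reasoning
    open +-*-Solver
    o = off a b
    Ra = sum (λ i → o i * F a i)
    Rb = sum (λ i → o i * F b i)
    C = sum (λ i → o i * (F i a + F i b))
    R = sum (λ i → o i * sum (λ j → o j * F i j))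
    cross : Ra + Rb + C ≡ sum (λ i → o i * (F a i + F b i + F i a + F i b))
    cross = sym (begin
      sum (λ i → o i * (F a i + F b i + F i a + F i b))
        ≡⟨ ∑-cong (λ i → solve 5 (λ o p q r s → o :* (p :+ q :+ r :+ s) := o :* p :+ o :* q :+ o :* (r :+ s))
                                refl (o i) (F a i) (F b i) (F i a) (F i b)) ⟩
      sum (λ i → o i * F a i + o i * F b i + o i * (F i a + F i b))
        ≡⟨ ∑-distrib-+ (λ i → o i * F a i + o i * F b i) _ ⟩
      sum (λ i → o i * F a i + o i * F b i) + C
        ≡⟨ cong (_+ C) (∑-distrib-+ (λ i → o i * F a i) _) ⟩
      Ra + Rb + C ∎)

-- Indicator of the pair (i, j) being an inversion of `p`, as a product defined on all pairs, so
-- that the length becomes a full double sum.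
inv : (Fin n → ℕ) → Fin n → Fin n → ℕ
inv p i j = lt (toℕ i) (toℕ j) * lt (p j) (p i)

length-filter-tabulate : ∀ {B : Set} {P : Pred B 0ℓ} (P? : Decidable P) (f : Fin n → A) (g : A → B) →
  length (filter P? (map g (tabulate f))) ≡ sum (λ i → bit (does (P? (g (f i)))))
length-filter-tabulate {n = zero}  P? f g = refl
length-filter-tabulate {n = suc n} P? f g with does (P? (g (f zero)))
... | true  = cong suc (length-filter-tabulate P? (f ∘ suc) g)
... | false = length-filter-tabulate P? (f ∘ suc) g

length-filter-cartesianProduct : ∀ {B : Set} {P : Pred (A × B) 0ℓ} (P? : Decidable P) (f : Fin n → A) (ys : List B) →
  length (filter P? (cartesianProduct (tabulate f) ys)) ≡ sum (λ i → length (filter P? (map (f i ,_) ys)))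
length-filter-cartesianProduct {n = zero}  P? f ys = refl
length-filter-cartesianProduct {n = suc n} P? f ys = begin
  length (filter P? (map (f zero ,_) ys List.++ rest))
    ≡⟨ cong length (List.filter-++ P? (map (f zero ,_) ys) rest) ⟩
  length (filter P? (map (f zero ,_) ys) List.++ filter P? rest)
    ≡⟨ List.length-++ (filter P? (map (f zero ,_) ys)) ⟩
  length (filter P? (map (f zero ,_) ys)) + length (filter P? rest)
    ≡⟨ cong (length (filter P? (map (f zero ,_) ys)) +_) (length-filter-cartesianProduct P? (f ∘ suc) ys) ⟩
  _ ∎
  where
  open ≡-Reasoning
  rest = cartesianProduct (tabulate (f ∘ suc)) ys

ℓ-sum : (w : Perm n) → ℓ w ≡ sum (λ i → sum (inv (toℕ ∘ lookup w) i))
ℓ-sum {n} w =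
  trans (length-filter-cartesianProduct inv? id (allFin n))
        (∑-cong λ i → trans (length-filter-tabulate inv? id (i ,_))
                            (∑-cong λ j → bit-∧ (does (i Fin.<? j)) (does (lookup w j Fin.<? lookup w i))))
  where
  inv? = λ (p : Fin n × Fin n) → (proj₁ p Fin.<? proj₂ p) ×-dec (lookup w (proj₂ p) Fin.<? lookup w (proj₁ p))

between : ℕ → ℕ → ℕ → ℕ
between x y z = lt x y * lt y z

between-yes : ∀ {x y z} → x < y → y < z → between x y z ≡ 1
between-yes x<y y<z = cong₂ _*_ (lt-yes x<y) (lt-yes y<z)

between-no : ∀ {x y z} → ¬ (x < y × y < z) → between x y z ≡ 0
between-no {x} {y} {z} ¬between with x <? y | y <? z
... | yes x<y | yes y<z = ⊥-elim (¬between (x<y , y<z))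
... | yes x<y | no y≮z  = trans (cong (lt x y *_) (lt-no (ℕ.≮⇒≥ y≮z))) (ℕ.*-zeroʳ (lt x y))
... | no x≮y  | _       = cong (_* lt y z) (lt-no (ℕ.≮⇒≥ x≮y))

-- The indicators of x < y, z < y, y < x, y < z when x < z and y differs from both.
data Sides : ℕ → ℕ → ℕ → ℕ → Set where
  below  : Sides 0 0 1 1
  middle : Sides 1 0 0 1
  above  : Sides 1 1 0 0

sides : ∀ {x y z} → x < z → y ≢ x → y ≢ z → Sides (lt x y) (lt z y) (lt y x) (lt y z)
sides {x} {y} {z} x<z y≢x y≢z with ℕ.<-cmp y x
... | tri< y<x _ _
  rewrite lt-no (ℕ.<⇒≤ y<x) | lt-no (ℕ.<⇒≤ (ℕ.<-trans y<x x<z)) | lt-yes y<x | lt-yes (ℕ.<-trans y<x x<z) = below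
... | tri≈ _ y≡x _ = ⊥-elim (y≢x y≡x)
... | tri> _ _ x<y with ℕ.<-cmp y z
...   | tri< y<z _ _ rewrite lt-yes x<y | lt-no (ℕ.<⇒≤ y<z) | lt-no (ℕ.<⇒≤ x<y) | lt-yes y<z = middle
...   | tri≈ _ y≡z _ = ⊥-elim (y≢z y≡z)
...   | tri> _ _ z<y rewrite lt-yes x<y | lt-yes z<y | lt-no (ℕ.<⇒≤ x<y) | lt-no (ℕ.<⇒≤ z<y) = above

-- ai is the indicator of a < i, etc.; x, y, z are the values at positions a, i, b before the swap.
cross-swap : ∀ {ai bi ia ib xy zy yx yz} → Sides ai bi ia ib → Sides xy zy yx yz →
  ai * yz + bi * yx + ia * zy + ib * xy ≡
  ai * yx + bi * yz + ia * xy + ib * zy + 2 * ((ai * ib) * (xy * yz))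
cross-swap below  below  = refl
cross-swap below  middle = refl
cross-swap below  above  = refl
cross-swap middle below  = refl
cross-swap middle middle = refl
cross-swap middle above  = refl
cross-swap above  below  = refl
cross-swap above  middle = refl
cross-swap above  above  = refl

sum-*2 : (f : Fin n → ℕ) → sum (λ i → 2 * f i) ≡ 2 * sum f
sum-*2 f = trans (∑-distrib-+ f (λ i → f i + 0)) (cong (sum f +_) (trans (∑-cong (λ i → ℕ.+-identityʳ (f i))) (sym (ℕ.+-identityʳ _))))

module _ {a b : Fin n} (p q : Fin n → ℕ) (a<b : a Fin.< b) (pa<pb : p a < p b)
         (qa : q a ≡ p b) (qb : q b ≡ p a) (q-off : ∀ i → i ≢ a → i ≢ b → q i ≡ p i)
         (≢pa : ∀ i → i ≢ a → p i ≢ p a) (≢pb : ∀ i → i ≢ b → p i ≢ p b) where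

  private
    a≢b : a ≢ b
    a≢b = Fin.<⇒≢ a<b

    N : Fin n → ℕ
    N i = between (toℕ a) (toℕ i) (toℕ b) * between (p a) (p i) (p b)

    cross : (Fin n → Fin n → ℕ) → Fin n → ℕ
    cross F i = F a i + F b i + F i a + F i b

    cross≡ : ∀ i → off a b i * cross (inv q) i ≡ off a b i * cross (inv p) i + 2 * N i
    cross≡ i with off-cases a b i
    -- At `a` and `b` themselves `off` kills the cross terms, and `N` vanishes because `between` is
    -- strict.
    ... | inj₁ (inj₁ refl , eq) rewrite eq | lt-no (ℕ.≤-refl {toℕ a}) = refl
    ... | inj₁ (inj₂ refl , eq) rewrite eq | lt-no (ℕ.≤-refl {toℕ b}) | ℕ.*-zeroʳ (lt (toℕ a) (toℕ b)) = refl
    ... | inj₂ (i≢a , i≢b , eq) rewrite eq | qa | qb | q-off i i≢a i≢b | ℕ.+-identityʳ (cross (inv p) i) =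
      trans (ℕ.+-identityʳ _)
        (cross-swap (sides a<b (i≢a ∘ Fin.toℕ-injective) (i≢b ∘ Fin.toℕ-injective)) (sides pa<pb (≢pa i i≢a) (≢pb i i≢b)))

    off-inv≡ : ∀ {i} → i ≢ a → i ≢ b → ∀ j → off a b j * inv q i j ≡ off a b j * inv p i j
    off-inv≡ {i} i≢a i≢b j with off-cases a b j
    ... | inj₁ (_ , eq) rewrite eq = refl
    ... | inj₂ (j≢a , j≢b , _) rewrite q-off i i≢a i≢b | q-off j j≢a j≢b = refl

    rest≡ : ∀ i → off a b i * sum (λ j → off a b j * inv q i j) ≡ off a b i * sum (λ j → off a b j * inv p i j)
    rest≡ i with off-cases a b i
    ... | inj₁ (_ , eq) rewrite eq = refl
    ... | inj₂ (i≢a , i≢b , _) = cong (off a b i *_) (∑-cong (off-inv≡ i≢a i≢b))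

    corner≡ : inv q a a + inv q a b + inv q b a + inv q b b ≡ 1 + (inv p a a + inv p a b + inv p b a + inv p b b)
    corner≡ rewrite lt-no (ℕ.≤-refl {toℕ a}) | lt-no (ℕ.≤-refl {toℕ b}) | lt-yes a<b | lt-no (ℕ.<⇒≤ a<b) | qa | qb
                  | lt-yes pa<pb | lt-no (ℕ.<⇒≤ pa<pb) = refl

  -- Here `q` is `p` with the values at `a` and `b` exchanged. The corner gains the inversion (a,
  -- b); every other position nets two new inversions, with `a` and with `b`, if counted by `N`, and
  -- none otherwise; pairs avoiding both positions are unchanged.
  sum-inv-swap : sum (λ i → sum (inv q i)) ≡ 1 + (sum (λ i → sum (inv p i)) + 2 * sum N)
  sum-inv-swap = begin
    sum (λ i → sum (inv q i))
      ≡⟨ sum²-split a≢b (inv q) ⟩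
    K′ + (sum (λ i → off a b i * cross (inv q) i) + sum (λ i → off a b i * sum (λ j → off a b j * inv q i j)))
      ≡⟨ cong₂ _+_ corner≡ (cong₂ _+_
           (trans (∑-cong cross≡) (∑-distrib-+ _ (λ i → 2 * N i)))
           (∑-cong rest≡)) ⟩
    1 + K + (X + sum (λ i → 2 * N i) + R)
      ≡⟨ cong (λ z → 1 + K + (X + z + R)) (sum-*2 N) ⟩
    1 + K + (X + 2 * sum N + R)
      ≡⟨ solve 4 (λ k x s r → con 1 :+ k :+ (x :+ s :+ r) := con 1 :+ ((k :+ (x :+ r)) :+ s)) refl K X (2 * sum N) R ⟩
    1 + (K + (X + R) + 2 * sum N)
      ≡⟨ cong (λ z → 1 + (z + 2 * sum N)) (sym (sum²-split a≢b (inv p))) ⟩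
    _ ∎
    where
    open ≡-Reasoning
    open +-*-Solver
    K′ = inv q a a + inv q a b + inv q b a + inv q b b
    K = inv p a a + inv p a b + inv p b a + inv p b b
    X = sum (λ i → off a b i * cross (inv p) i)
    R = sum (λ i → off a b i * sum (λ j → off a b j * inv p i j))

sum-lt : ∀ m → m ≤ n → sum {n} (λ i → lt (toℕ i) m) ≡ m
sum-lt {n}     zero    m≤n = ≡0⇒sum≡0 {n} _ (λ i → lt-no {toℕ i} z≤n)
sum-lt {suc n} (suc m) (s≤s m≤n) = cong₂ _+_ (lt-yes {0} {suc m} (s≤s z≤n)) (sum-lt m m≤n)

-- The positions before `b` are those up to `a` and those strictly between; the additive form avoids
-- truncated subtraction.
sum-between : (a b : Fin n) → a Fin.< b → suc (toℕ a) + sum {n} (λ i → between (toℕ a) (toℕ i) (toℕ b)) ≡ toℕ b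
sum-between {n} a b a<b = begin
  suc (toℕ a) + sum g                      ≡⟨ cong (_+ sum g) (sym (sum-lt (suc (toℕ a)) (Fin.toℕ<n a))) ⟩
  sum {n} (λ i → lt (toℕ i) (suc (toℕ a))) + sum g ≡⟨ sym (∑-distrib-+ (λ i → lt (toℕ i) (suc (toℕ a))) g) ⟩
  sum {n} (λ i → lt (toℕ i) (suc (toℕ a)) + g i)  ≡⟨ ∑-cong {n} pw ⟩
  sum {n} (λ i → lt (toℕ i) (toℕ b))         ≡⟨ sum-lt (toℕ b) (ℕ.<⇒≤ (Fin.toℕ<n b)) ⟩
  toℕ b ∎
  where
  open ≡-Reasoning
  g : Fin n → ℕ
  g i = between (toℕ a) (toℕ i) (toℕ b)
  pw : ∀ i → lt (toℕ i) (suc (toℕ a)) + g i ≡ lt (toℕ i) (toℕ b)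
  pw i with ℕ.≤-<-connex (toℕ i) (toℕ a)
  ... | inj₁ i≤a rewrite lt-yes (s≤s i≤a) | lt-no i≤a | lt-yes (ℕ.≤-<-trans i≤a a<b) = refl
  ... | inj₂ a<i rewrite lt-no {toℕ i} {suc (toℕ a)} a<i | lt-yes a<i = ℕ.+-identityʳ _

lookup-ext : ∀ {u v : Vec.Vec A n} → (∀ i → lookup u i ≡ lookup v i) → u ≡ v
lookup-ext {u = u} {v} eq =
  trans (sym (Vec.tabulate∘lookup u)) (trans (Vec.tabulate-cong eq) (Vec.tabulate∘lookup v))

module _ (w : Perm n) {a b : Fin n} where

  lookup-swapˡ : a ≢ b → lookup (swap w a b) a ≡ lookup w b
  lookup-swapˡ a≢b = trans (Vec.lookup∘update′ a≢b (w Vec.[ a ]≔ lookup w b) (lookup w a)) (Vec.lookup∘update a w (lookup w b))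

  lookup-swapʳ : lookup (swap w a b) b ≡ lookup w a
  lookup-swapʳ = Vec.lookup∘update b (w Vec.[ a ]≔ lookup w b) (lookup w a)

  lookup-swap-≢ : ∀ {i} → i ≢ a → i ≢ b → lookup (swap w a b) i ≡ lookup w i
  lookup-swap-≢ i≢a i≢b = trans (Vec.lookup∘update′ i≢b (w Vec.[ a ]≔ lookup w b) (lookup w a)) (Vec.lookup∘update′ i≢a w (lookup w b))

swap-involutive : ∀ (w : Perm n) {a b} → a ≢ b → swap (swap w a b) a b ≡ w
swap-involutive {n} w {a} {b} a≢b = lookup-ext pointwise
  where
  v : Perm n
  v = swap w a b
  pointwise : ∀ i → lookup (swap v a b) i ≡ lookup w i
  pointwise i with i Fin.≟ a | i Fin.≟ b
  ... | yes refl | _        = trans (lookup-swapˡ v a≢b) (lookup-swapʳ w)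
  ... | no _     | yes refl = trans (lookup-swapʳ v) (lookup-swapˡ w a≢b)
  ... | no i≢a   | no i≢b   = trans (lookup-swap-≢ v i≢a i≢b) (lookup-swap-≢ w i≢a i≢b)

-- The swapped word is `w` read along the transposition `τ`, which is an involution and hence
-- injective.
swap-isPerm : ∀ (w : Perm n) {a b} → a ≢ b → IsPerm w → IsPerm (swap w a b)
swap-isPerm {n} w {a} {b} a≢b w-perm i j eq = begin
  i       ≡⟨ sym (τ-involutive i) ⟩
  τ (τ i) ≡⟨ cong τ (w-perm (τ i) (τ j) (trans (sym (at i)) (trans eq (at j)))) ⟩
  τ (τ j) ≡⟨ τ-involutive j ⟩
  j       ∎
  where
  open ≡-Reasoning
  τ : Fin n → Fin n
  τ i with i Fin.≟ a | i Fin.≟ b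
  ... | yes _ | _     = b
  ... | no _  | yes _ = a
  ... | no _  | no _  = i
  at : ∀ i → lookup (swap w a b) i ≡ lookup w (τ i)
  at i with i Fin.≟ a | i Fin.≟ b
  ... | yes refl | _        = lookup-swapˡ w a≢b
  ... | no _     | yes refl = lookup-swapʳ w
  ... | no i≢a   | no i≢b   = lookup-swap-≢ w i≢a i≢b
  τ-involutive : ∀ i → τ (τ i) ≡ i
  τ-involutive i with i Fin.≟ a in eqa | i Fin.≟ b in eqb
  τ-involutive i | yes refl | _ with b Fin.≟ i | b Fin.≟ b
  ... | yes b≡i | _     = b≡i
  ... | no _    | yes _ = refl
  ... | no _    | no b≢b = ⊥-elim (b≢b refl)
  τ-involutive i | no _ | yes refl with a Fin.≟ a
  ... | yes _ = refl
  ... | no a≢a = ⊥-elim (a≢a refl)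
  τ-involutive i | no _ | no _ rewrite eqa | eqb = refl

-- y lies strictly inside the arc from x up to z in the cyclic order of Fin n.
Cyc : (x y z : Fin n) → Set
Cyc x y z = (x Fin.< y × y Fin.< z) ⊎ (y Fin.< z × z Fin.< x) ⊎ (z Fin.< x × x Fin.< y)

-- The excess `2 * d` that one folding contributes to the doubled equation. The two implications
-- make its vanishing equivalent to `P`, below always an edge condition.
Defect : ℕ → ℕ → Set → Set
Defect x y P = ∃ λ d → x ≡ 1 + y + 2 * d × (d ≡ 0 → P) × (P → d ≡ 0)

-- w → w(a,b) reverses an edge of the quantum Bruhat graph: no entry strictly between positions
-- a and b lies on the cyclic arc from w(b) up to w(a).  This covers both Bruhat covers
-- (w(b) < w(a)) and quantum edges (w(a) < w(b)).
Edge : Perm n → Fin n → Fin n → Set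
Edge w a b = ∀ i → a Fin.< i → i Fin.< b → ¬ Cyc (lookup w b) (lookup w i) (lookup w a)

module _ (w : Perm n) (w-perm : IsPerm w) {a b : Fin n} (a<b : a Fin.< b) where

  private
    a≢b : a ≢ b
    a≢b = Fin.<⇒≢ a<b

    p : Fin n → ℕ
    p = toℕ ∘ lookup w

    p-≢ : ∀ {i j} → i ≢ j → p i ≢ p j
    p-≢ i≢j eq = i≢j (w-perm _ _ (Fin.toℕ-injective eq))

    gap : Fin n → ℕ
    gap i = between (toℕ a) (toℕ i) (toℕ b)

    N : Fin n → ℕ
    N i = gap i * between (p a) (p i) (p b)

    N̅ : Fin n → ℕ
    N̅ i = gap i * (1 ∸ between (p a) (p i) (p b))

  ℓ-swap : p a < p b → ℓ (swap w a b) ≡ 1 + (ℓ w + 2 * sum N)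
  ℓ-swap pa<pb = trans (ℓ-sum (swap w a b)) (trans
    (sum-inv-swap p (toℕ ∘ lookup (swap w a b)) a<b pa<pb
      (cong toℕ (lookup-swapˡ w a≢b)) (cong toℕ (lookup-swapʳ w))
      (λ i i≢a i≢b → cong toℕ (lookup-swap-≢ w i≢a i≢b)) (λ i → p-≢) (λ i → p-≢))
    (cong (λ l → 1 + (l + 2 * sum N)) (sym (ℓ-sum w))))

  private
    between? : ∀ x y z → Dec (x < y × y < z)
    between? x y z = (x <? y) ×-dec (y <? z)

    -- `N` and `N̅` split the positions strictly between `a` and `b` by whether their value lies
    -- strictly between `p a` and `p b`.
    sum-gap : toℕ b ∸ toℕ a ≡ 1 + (sum N + sum N̅)
    sum-gap = begin
      toℕ b ∸ toℕ a                     ≡⟨ cong (_∸ toℕ a) (sym (sum-between a b a<b)) ⟩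
      suc (toℕ a) + sum gap ∸ toℕ a     ≡⟨ cong (_∸ toℕ a) (sym (ℕ.+-suc (toℕ a) (sum gap))) ⟩
      toℕ a + suc (sum gap) ∸ toℕ a     ≡⟨ ℕ.m+n∸m≡n (toℕ a) _ ⟩
      suc (sum gap)                     ≡⟨ cong suc (trans (∑-cong N+N̅) (∑-distrib-+ N N̅)) ⟩
      1 + (sum N + sum N̅)               ∎
      where
      open ≡-Reasoning
      N+N̅ : ∀ i → gap i ≡ N i + N̅ i
      N+N̅ i with between? (p a) (p i) (p b)
      ... | yes (pa<pi , pi<pb) rewrite between-yes pa<pi pi<pb | ℕ.*-identityʳ (gap i) | ℕ.*-zeroʳ (gap i) = sym (ℕ.+-identityʳ _)
      ... | no ¬between rewrite between-no ¬between | ℕ.*-identityʳ (gap i) | ℕ.*-zeroʳ (gap i) = refl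

    ∑gap*≡0⇒ : (f : Fin n → ℕ) → sum (λ i → gap i * f i) ≡ 0 → ∀ i → a Fin.< i → i Fin.< b → f i ≡ 0
    ∑gap*≡0⇒ f eq i a<i i<b with e ← sum≡0⇒≡0 (λ i → gap i * f i) eq i
      rewrite between-yes {toℕ a} {toℕ i} a<i i<b = trans (sym (ℕ.+-identityʳ _)) e

    ⇒∑gap*≡0 : (f : Fin n → ℕ) → (∀ i → a Fin.< i → i Fin.< b → f i ≡ 0) → sum (λ i → gap i * f i) ≡ 0
    ⇒∑gap*≡0 f eq = ≡0⇒sum≡0 _ pointwise
      where
      pointwise : ∀ i → gap i * f i ≡ 0
      pointwise i with between? (toℕ a) (toℕ i) (toℕ b)
      ... | yes (a<i , i<b) = trans (cong (gap i *_) (eq i a<i i<b)) (ℕ.*-zeroʳ (gap i))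
      ... | no ¬between = cong (_* f i) (between-no ¬between)

    v : Perm n
    v = swap w a b

    v-inside : ∀ {i} → a Fin.< i → i Fin.< b → lookup v i ≡ lookup w i
    v-inside a<i i<b = lookup-swap-≢ w (≢-sym (Fin.<⇒≢ a<i)) (Fin.<⇒≢ i<b)

  -- The folding from `v` back to `w` is positive. The arc from v(b) = w(a) up to v(a) = w(b) does
  -- not wrap around, so the positions violating the edge condition are those counted by `N`.
  ascent-swapped : p a < p b → Defect (ℓ v) (ℓ w) (Edge v a b)
  ascent-swapped pa<pb = sum N , ℓ-swap pa<pb , to , from
    where
    to : sum N ≡ 0 → Edge v a b
    to eq i a<i i<b rewrite lookup-swapˡ w a≢b | lookup-swapʳ w {a} {b} | v-inside a<i i<b = λ where
      (inj₁ (x<y , y<z)) → ℕ.1+n≢0 (trans (sym (between-yes x<y y<z)) (∑gap*≡0⇒ _ eq i a<i i<b))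
      (inj₂ (inj₁ (_ , z<x))) → ℕ.<-asym z<x pa<pb
      (inj₂ (inj₂ (z<x , _))) → ℕ.<-asym z<x pa<pb
    from : Edge v a b → sum N ≡ 0
    from edge = ⇒∑gap*≡0 _ λ i a<i i<b → between-no λ (x<y , y<z) → edge i a<i i<b
      (subst (λ q → Cyc (lookup v b) q (lookup v a)) (sym (v-inside a<i i<b))
        (inj₁ (subst (Fin._< lookup w i) (sym (lookup-swapʳ w)) x<y , subst (lookup w i Fin.<_) (sym (lookup-swapˡ w a≢b)) y<z)))

  -- The length grows by 1 + 2N while the weight contributes 2 + 2N + 2N̅, so the excess is `N̅`.
  -- The arc from w(b) up to w(a) now wraps around, and its interior consists of the values outside
  -- the interval from w(a) to w(b).
  ascent : p a < p b → Defect (ℓ w + 2 * ρβ (a , b)) (ℓ v) (Edge w a b)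
  ascent pa<pb = sum N̅ , eqn , to , from
    where
    open +-*-Solver
    eqn : ℓ w + 2 * ρβ (a , b) ≡ 1 + ℓ v + 2 * sum N̅
    eqn rewrite ℓ-swap pa<pb | sum-gap =
      solve 3 (λ l x y → l :+ con 2 :* (con 1 :+ (x :+ y)) := con 1 :+ (con 1 :+ (l :+ con 2 :* x)) :+ con 2 :* y)
        refl (ℓ w) (sum N) (sum N̅)
    to : sum N̅ ≡ 0 → Edge w a b
    to eq i a<i i<b cyc = ℕ.1+n≢0 (trans (cong (1 ∸_) (sym (between-no (outside cyc)))) (∑gap*≡0⇒ _ eq i a<i i<b))
      where
      outside : Cyc (lookup w b) (lookup w i) (lookup w a) → ¬ (p a < p i × p i < p b)
      outside (inj₁ (b<i , i<a))        (a<i , _)   = ℕ.<-asym i<a a<i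
      outside (inj₂ (inj₁ (i<a , _)))   (a<i , _)   = ℕ.<-asym i<a a<i
      outside (inj₂ (inj₂ (_ , b<i)))   (_ , i<b)   = ℕ.<-asym b<i i<b
    from : Edge w a b → sum N̅ ≡ 0
    from edge = ⇒∑gap*≡0 _ λ i a<i i<b → cong (1 ∸_) (between-yes (lower a<i i<b) (upper a<i i<b))
      where
      lower : ∀ {i} → a Fin.< i → i Fin.< b → p a < p i
      lower {i} a<i i<b with ℕ.<-cmp (p a) (p i)
      ... | tri< pa<pi _ _ = pa<pi
      ... | tri≈ _ pa≡pi _ = ⊥-elim (p-≢ (Fin.<⇒≢ a<i) pa≡pi)
      ... | tri> _ _ pi<pa = ⊥-elim (edge i a<i i<b (inj₂ (inj₁ (pi<pa , pa<pb))))
      upper : ∀ {i} → a Fin.< i → i Fin.< b → p i < p b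
      upper {i} a<i i<b with ℕ.<-cmp (p i) (p b)
      ... | tri< pi<pb _ _ = pi<pb
      ... | tri≈ _ pi≡pb _ = ⊥-elim (p-≢ (Fin.<⇒≢ i<b) pi≡pb)
      ... | tri> _ _ pb<pi = ⊥-elim (edge i a<i i<b (inj₂ (inj₂ (pa<pb , pb<pi))))

≡⇒< : ∀ {x y} d → x ≡ 1 + y + d → y < x
≡⇒< d refl = ℕ.m≤m+n _ d

module _ (w : Perm n) (w-perm : IsPerm w) {a b : Fin n} (a<b : a Fin.< b) where

  private
    a≢b : a ≢ b
    a≢b = Fin.<⇒≢ a<b

    v : Perm n
    v = swap w a b

    v-perm : IsPerm v
    v-perm = swap-isPerm w a≢b w-perm

  -- `v` has an ascent at (a, b) and swapping it back gives `w`, so this is `ascent-swapped` for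
  -- `v`.
  descent : lookup w b Fin.< lookup w a → Defect (ℓ w) (ℓ v) (Edge w a b)
  descent wb<wa = subst (λ u → Defect (ℓ u) (ℓ v) (Edge u a b))
    (swap-involutive w a≢b)
    (ascent-swapped v v-perm a<b (subst₂ Fin._<_ (sym (lookup-swapˡ w a≢b)) (sym (lookup-swapʳ w)) wb<wa))

  ascent⇒ℓ< : lookup w a Fin.< lookup w b → ℓ w < ℓ v
  ascent⇒ℓ< wa<wb = let d , eq , _ = ascent-swapped w w-perm a<b wa<wb in ≡⇒< (2 * d) eq

  descent⇒ℓ> : lookup w b Fin.< lookup w a → ℓ v < ℓ w
  descent⇒ℓ> wb<wa = let d , eq , _ = descent wb<wa in ≡⇒< (2 * d) eq

  ascent-or-descent : lookup w a Fin.< lookup w b ⊎ lookup w b Fin.< lookup w a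
  ascent-or-descent with Fin.<-cmp (lookup w a) (lookup w b)
  ... | tri< wa<wb _ _ = inj₁ wa<wb
  ... | tri≈ _ wa≡wb _ = ⊥-elim (a≢b (w-perm a b wa≡wb))
  ... | tri> _ _ wb<wa = inj₂ wb<wa

-- Lets lengths decide whether a negative or positive folding swaps an ascent or a descent.
<B⇒ℓ< : {u v : Perm n} → u <B v → ℓ u < ℓ v
<B⇒ℓ< [ _ , _ , _ , _ , ℓ< ]        = ℓ<
<B⇒ℓ< ((_ , _ , _ , _ , ℓ<) ∷⁺ u<v) = ℕ.<-trans ℓ< (<B⇒ℓ< u<v)

-- Foldings and paths in the quantum Bruhat graph

-- Runs in which every folding reverses a quantum Bruhat edge. One constructor serves both signs,
-- since `Edge` treats Bruhat covers and quantum edges alike.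
data Path {n} : Perm n → List (Root n) → List Bool → Perm n → Set where
  done : ∀ {w} → Path w [] [] w
  skip : ∀ {w β βs J u} → Path w βs J u → Path w (β ∷ βs) (false ∷ J) u
  fold : ∀ {w a b βs J u} → Edge w a b → Path (swap w a b) βs J u → Path w ((a , b) ∷ βs) (true ∷ J) u

Positive : Root n → Set
Positive (a , b) = a Fin.< b

-- Paths are built backwards from their end, so the property is carried from end to start by undoing
-- each swap.
Path-isPerm : ∀ {w u : Perm n} {βs J} → All Positive βs → Path w βs J u → IsPerm u → IsPerm w
Path-isPerm _          done          u-perm = u-perm
Path-isPerm (_ ∷ βs>0) (skip path)   u-perm = Path-isPerm βs>0 path u-perm
Path-isPerm {w = w} (a<b ∷ βs>0) (fold {a = a} {b} _ path) u-perm =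
  subst IsPerm (swap-involutive w (Fin.<⇒≢ a<b)) (swap-isPerm (swap w a b) (Fin.<⇒≢ a<b) (Path-isPerm βs>0 path u-perm))

private
  total-neg : ∀ {x y r d s D c z} → x + 2 * r ≡ 1 + y + 2 * d → y + 2 * s ≡ z + c + D →
    x + 2 * (r + s) ≡ z + suc c + (2 * d + D)
  total-neg {x} {y} {r} {d} {s} {D} {c} {z} eq′ eq = begin
    x + 2 * (r + s)             ≡⟨ solve 3 (λ l r s → l :+ con 2 :* (r :+ s) := l :+ con 2 :* r :+ con 2 :* s) refl x r s ⟩
    x + 2 * r + 2 * s           ≡⟨ cong (_+ 2 * s) eq′ ⟩
    1 + y + 2 * d + 2 * s       ≡⟨ solve 3 (λ l d s → con 1 :+ l :+ d :+ s := con 1 :+ d :+ (l :+ s)) refl y (2 * d) (2 * s) ⟩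
    1 + 2 * d + (y + 2 * s)     ≡⟨ cong (1 + 2 * d +_) eq ⟩
    1 + 2 * d + (z + c + D)     ≡⟨ solve 4 (λ d u c D → con 1 :+ d :+ (u :+ c :+ D) := u :+ (con 1 :+ c) :+ (d :+ D)) refl (2 * d) z c D ⟩
    z + suc c + (2 * d + D)     ∎
    where
    open ≡-Reasoning
    open +-*-Solver

  total-pos : ∀ {x y d s D c z} → x ≡ 1 + y + 2 * d → y + 2 * s ≡ z + c + D →
    x + 2 * s ≡ z + suc c + (2 * d + D)
  total-pos {x} {y} {d} {s} {D} {c} {z} eq′ eq = total-neg {x} {y} {0} {d} {s} {D} {c} {z} (trans (ℕ.+-identityʳ x) eq′) eq

  drop-defect : ∀ {x y d} → d ≡ 0 → x ≡ y + (2 * d + 0) → x ≡ y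
  drop-defect refl eq = trans eq (ℕ.+-identityʳ _)

module _ (w : Perm n) (a b : Fin n) {βs : List (Root n)} {J : List Bool} (u : Perm n) (s : ℕ) where

  private
    v : Perm n
    v = swap w a b

  defect-neg : Defect (ℓ w + 2 * ρβ (a , b)) (ℓ v) (Edge w a b) →
    (∃ λ D → ℓ v + 2 * s ≡ ℓ u + count J + D × (D ≡ 0 → Path v βs J u)) →
    ∃ λ D → ℓ w + 2 * (ρβ (a , b) + s) ≡ ℓ u + suc (count J) + D × (D ≡ 0 → Path w ((a , b) ∷ βs) (true ∷ J) u)
  defect-neg (d , eq′ , edge , _) (D , eq , path) =
    2 * d + D , total-neg {ℓ w} {ℓ v} {ρβ (a , b)} {d} {s} {D} {count J} {ℓ u} eq′ eq ,
    λ z → fold (edge (ℕ.m+n≡0⇒m≡0 d (ℕ.m+n≡0⇒m≡0 (2 * d) z))) (path (ℕ.m+n≡0⇒n≡0 (2 * d) z))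

  defect-pos : Defect (ℓ w) (ℓ v) (Edge w a b) →
    (∃ λ D → ℓ v + 2 * s ≡ ℓ u + count J + D × (D ≡ 0 → Path v βs J u)) →
    ∃ λ D → ℓ w + 2 * s ≡ ℓ u + suc (count J) + D × (D ≡ 0 → Path w ((a , b) ∷ βs) (true ∷ J) u)
  defect-pos (d , eq′ , edge , _) (D , eq , path) =
    2 * d + D , total-pos {ℓ w} {ℓ v} {d} {s} {D} {count J} {ℓ u} eq′ eq ,
    λ z → fold (edge (ℕ.m+n≡0⇒m≡0 d (ℕ.m+n≡0⇒m≡0 (2 * d) z))) (path (ℕ.m+n≡0⇒n≡0 (2 * d) z))

  neg-exact : Defect (ℓ w + 2 * ρβ (a , b)) (ℓ v) (Edge w a b) → Edge w a b →
    ℓ v + 2 * s ≡ ℓ u + count J → ℓ w + 2 * (ρβ (a , b) + s) ≡ ℓ u + suc (count J)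
  neg-exact (d , eq′ , _ , d≡0) edge eq = drop-defect (d≡0 edge)
    (total-neg {ℓ w} {ℓ v} {ρβ (a , b)} {d} {s} {0} {count J} {ℓ u} eq′ (trans eq (sym (ℕ.+-identityʳ _))))

  pos-exact : Defect (ℓ w) (ℓ v) (Edge w a b) → Edge w a b →
    ℓ v + 2 * s ≡ ℓ u + count J → ℓ w + 2 * s ≡ ℓ u + suc (count J)
  pos-exact (d , eq′ , _ , d≡0) edge eq = drop-defect (d≡0 edge)
    (total-pos {ℓ w} {ℓ v} {d} {s} {0} {count J} {ℓ u} eq′ (trans eq (sym (ℕ.+-identityʳ _))))

-- The total defect D is the sum of nonnegative local defects, one for each folding.
FoldRun⇒Path : ∀ {w u : Perm n} {βs J s} → All Positive βs → IsPerm w → FoldRun w βs J u s →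
  ∃ λ D → ℓ w + 2 * s ≡ ℓ u + count J + D × (D ≡ 0 → Path w βs J u)
FoldRun⇒Path _ _ done = 0 , sym (ℕ.+-identityʳ _) , λ _ → done
FoldRun⇒Path (_ ∷ βs>0) w-perm (skip run) =
  let D , eq , path = FoldRun⇒Path βs>0 w-perm run in D , eq , λ D≡0 → skip (path D≡0)
FoldRun⇒Path {w = w} {u} (a<b ∷ βs>0) w-perm (neg {a = a} {b} {s = s} w<v run) with ascent-or-descent w w-perm a<b
... | inj₁ wa<wb = defect-neg w a b u s (ascent w w-perm a<b wa<wb) (FoldRun⇒Path βs>0 (swap-isPerm w (Fin.<⇒≢ a<b) w-perm) run)
... | inj₂ wb<wa = ⊥-elim (ℕ.<-asym {ℓ w} {ℓ (swap w a b)} (<B⇒ℓ< w<v) (descent⇒ℓ> w w-perm a<b wb<wa))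
FoldRun⇒Path {w = w} {u} (a<b ∷ βs>0) w-perm (pos {a = a} {b} {s = s} v<w run) with ascent-or-descent w w-perm a<b
... | inj₁ wa<wb = ⊥-elim (ℕ.<-asym {ℓ (swap w a b)} {ℓ w} (<B⇒ℓ< v<w) (ascent⇒ℓ< w w-perm a<b wa<wb))
... | inj₂ wb<wa = defect-pos w a b u s (descent w w-perm a<b wb<wa) (FoldRun⇒Path βs>0 (swap-isPerm w (Fin.<⇒≢ a<b) w-perm) run)

-- Edges have zero defect, so the lengths telescope exactly; the sign of each folding is recovered
-- by comparing the two swapped entries.
Path⇒FoldRun : ∀ {w u : Perm n} {βs J} → All Positive βs → IsPerm w → Path w βs J u →
  ∃ λ s → FoldRun w βs J u s × ℓ w + 2 * s ≡ ℓ u + count J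
Path⇒FoldRun _ _ done = 0 , done , refl
Path⇒FoldRun (_ ∷ βs>0) w-perm (skip path) =
  let s , run , eq = Path⇒FoldRun βs>0 w-perm path in s , skip run , eq
Path⇒FoldRun {w = w} {u} (a<b ∷ βs>0) w-perm (fold {a = a} {b} {βs} {J} edge path)
  with ascent-or-descent w w-perm a<b | Path⇒FoldRun βs>0 (swap-isPerm w (Fin.<⇒≢ a<b) w-perm) path
... | inj₁ wa<wb | s , run , eq =
  ρβ (a , b) + s , neg [ a , b , a<b , refl , ascent⇒ℓ< w w-perm a<b wa<wb ] run ,
  neg-exact w a b {βs} {J} u s (ascent w w-perm a<b wa<wb) edge eq
... | inj₂ wb<wa | s , run , eq =
  s , pos [ a , b , a<b , sym (swap-involutive w (Fin.<⇒≢ a<b)) , descent⇒ℓ> w w-perm a<b wb<wa ] run ,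
  pos-exact w a b {βs} {J} u s (descent w w-perm a<b wb<wa) edge eq

-- The identity as the only permutation of length zero

perm-surjective : (w : Perm n) → IsPerm w → ∀ x → ∃ λ i → lookup w i ≡ x
perm-surjective {suc n} w w-perm x with Fin.any? (λ i → lookup w i Fin.≟ x)
... | yes hit = hit
-- Punching out a missed value would inject `Fin (suc n)` into `Fin n`.
... | no miss = ⊥-elim (ℕ.1+n≰n (Fin.injective⇒≤ {f = λ i → Fin.punchOut (miss′ i)}
        (λ {i} {j} eq → w-perm i j (Fin.punchOut-injective (miss′ i) (miss′ j) eq))))
  where
  miss′ : ∀ i → x ≢ lookup w i
  miss′ i eq = miss (i , sym eq)

increasing⇒≥ : (f : Fin n → Fin n) → (∀ {i j} → i Fin.< j → f i Fin.< f j) → ∀ i → i Fin.≤ f i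
increasing⇒≥ f mono i = go (toℕ i) i refl
  where
  go : ∀ k i → toℕ i ≡ k → k ≤ toℕ (f i)
  go zero    i eq = z≤n
  go (suc k) i eq = ℕ.≤-<-trans (go k i′ toℕi′) (mono (ℕ.≤-reflexive (trans (cong suc toℕi′) (sym eq))))
    where
    k<n = ℕ.<-trans (ℕ.n<1+n k) (subst (_< _) eq (Fin.toℕ<n i))
    i′ = Fin.fromℕ< k<n
    toℕi′ = Fin.toℕ-fromℕ< k<n

idPerm : Perm n
idPerm {n} = Vec.allFin n

idPerm-isPerm : IsPerm (idPerm {n})
idPerm-isPerm i j eq = trans (sym (Vec.lookup-allFin i)) (trans eq (Vec.lookup-allFin j))

ℓ-idPerm : ℓ (idPerm {n}) ≡ 0
ℓ-idPerm {n} = trans (ℓ-sum (idPerm {n})) (≡0⇒sum≡0 (λ i → sum (inv p i)) λ i → ≡0⇒sum≡0 (inv p i) (no-inv i))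
  where
  p : Fin n → ℕ
  p = toℕ ∘ lookup (idPerm {n})
  no-inv : ∀ i j → inv p i j ≡ 0
  no-inv i j rewrite Vec.lookup-allFin i | Vec.lookup-allFin j with toℕ i <? toℕ j
  ... | yes i<j rewrite lt-no (ℕ.<⇒≤ i<j) = ℕ.*-zeroʳ (lt (toℕ i) (toℕ j))
  ... | no i≮j rewrite lt-no (ℕ.≮⇒≥ i≮j) = refl

-- Without inversions `w` is increasing, and so is its inverse. Each lies pointwise above the
-- identity, which leaves only the identity.
ℓ≡0⇒idPerm : (w : Perm n) → IsPerm w → ℓ w ≡ 0 → w ≡ idPerm
ℓ≡0⇒idPerm w w-perm ℓw≡0 = lookup-ext λ i → trans (fixed i) (sym (Vec.lookup-allFin i))
  where
  increasing : ∀ {i j} → i Fin.< j → lookup w i Fin.< lookup w j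
  increasing {i} {j} i<j with ascent-or-descent w w-perm i<j
  ... | inj₁ wi<wj = wi<wj
  ... | inj₂ wj<wi = ⊥-elim (ℕ.1+n≢0 (trans (sym (cong₂ _*_ (lt-yes i<j) (lt-yes wj<wi)))
          (sum≡0⇒≡0 _ (sum≡0⇒≡0 _ (trans (sym (ℓ-sum w)) ℓw≡0) i) j)))
  w⁻¹ : Fin _ → Fin _
  w⁻¹ x = proj₁ (perm-surjective w w-perm x)
  w-w⁻¹ : ∀ x → lookup w (w⁻¹ x) ≡ x
  w-w⁻¹ x = proj₂ (perm-surjective w w-perm x)
  w⁻¹-increasing : ∀ {x y} → x Fin.< y → w⁻¹ x Fin.< w⁻¹ y
  w⁻¹-increasing {x} {y} x<y with Fin.<-cmp (w⁻¹ x) (w⁻¹ y)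
  ... | tri< lt _ _ = lt
  ... | tri≈ _ eq _ = ⊥-elim (Fin.<⇒≢ x<y (trans (sym (w-w⁻¹ x)) (trans (cong (lookup w) eq) (w-w⁻¹ y))))
  ... | tri> _ _ gt = ⊥-elim (ℕ.<-asym x<y (subst₂ Fin._<_ (w-w⁻¹ y) (w-w⁻¹ x) (increasing gt)))
  fixed : ∀ i → lookup w i ≡ i
  fixed i = Fin.≤-antisym
    (subst (lookup w i Fin.≤_) (w-perm _ _ (w-w⁻¹ (lookup w i))) (increasing⇒≥ w⁻¹ w⁻¹-increasing (lookup w i)))
    (increasing⇒≥ (lookup w) increasing i)

FoldRun-isPerm : ∀ {w u : Perm n} {βs J s} → All Positive βs → IsPerm w → FoldRun w βs J u s → IsPerm u
FoldRun-isPerm _            w-perm done         = w-perm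
FoldRun-isPerm (_ ∷ βs>0)   w-perm (skip run)   = FoldRun-isPerm βs>0 w-perm run
FoldRun-isPerm {w = w} (a<b ∷ βs>0) w-perm (neg _ run)  = FoldRun-isPerm βs>0 (swap-isPerm w (Fin.<⇒≢ a<b) w-perm) run
FoldRun-isPerm {w = w} (a<b ∷ βs>0) w-perm (pos _ run)  = FoldRun-isPerm βs>0 (swap-isPerm w (Fin.<⇒≢ a<b) w-perm) run

-- Subtracting the membership equation from the total defect identity leaves 2ℓ(u) + D = 0: the end
-- has length zero and every local defect vanishes.
exact⇒Path : ∀ {w u : Perm n} {βs J s} → All Positive βs → IsPerm w → FoldRun w βs J u s →
  ℓ w + ℓ u + 2 * s ≡ count J → Path w βs J idPerm
exact⇒Path {w = w} {u} {βs} {J} {s} βs>0 w-perm run eq =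
  subst (Path w βs J) (ℓ≡0⇒idPerm u (FoldRun-isPerm βs>0 w-perm run) (ℕ.m+n≡0⇒m≡0 (ℓ u) (ℕ.m+n≡0⇒m≡0 _ zero-sum)))
    (path (ℕ.m+n≡0⇒n≡0 (ℓ u + ℓ u) zero-sum))
  where
  defect = FoldRun⇒Path βs>0 w-perm run
  D = proj₁ defect
  path = proj₂ (proj₂ defect)
  zero-sum : ℓ u + ℓ u + D ≡ 0
  zero-sum = cancel {ℓ w} {ℓ u} {2 * s} {count J} {D} eq (proj₁ (proj₂ defect))
    where
    cancel : ∀ {x y z c D} → x + y + z ≡ c → x + z ≡ y + c + D → y + y + D ≡ 0
    cancel {x} {y} {z} {c} {D} eq eq′ = ℕ.m+n≡0⇒m≡0 _ {0} (trans (ℕ.+-identityʳ _) (ℕ.+-cancelˡ-≡ c _ _ (begin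
      c + (y + y + D)     ≡⟨ solve 3 (λ c y D → c :+ (y :+ y :+ D) := y :+ (y :+ c :+ D)) refl c y D ⟩
      y + (y + c + D)     ≡⟨ cong (y +_) (sym eq′) ⟩
      y + (x + z)         ≡⟨ solve 3 (λ x y z → y :+ (x :+ z) := x :+ y :+ z) refl x y z ⟩
      x + y + z           ≡⟨ eq ⟩
      c                   ≡⟨ sym (ℕ.+-identityʳ c) ⟩
      c + 0               ∎)))
      where
      open ≡-Reasoning
      open +-*-Solver

Path⇒exact : ∀ {w : Perm n} {βs J} → All Positive βs → IsPerm w → Path w βs J idPerm →
  ∃₂ λ u s → FoldRun w βs J u s × ℓ w + ℓ u + 2 * s ≡ count J
Path⇒exact {n} {w} {J = J} βs>0 w-perm path =
  let s , run , eq = Path⇒FoldRun βs>0 w-perm path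
  in idPerm , s , run , cancel {ℓ w} {ℓ (idPerm {n})} {2 * s} {count J} (ℓ-idPerm {n}) eq
  where
  cancel : ∀ {x e z c} → e ≡ 0 → x + z ≡ e + c → x + e + z ≡ c
  cancel {x} {z = z} refl eq = trans (cong (_+ z) (ℕ.+-identityʳ x)) eq

-- The cyclic order on values

Cyc? : (x y z : Fin n) → Dec (Cyc x y z)
Cyc? x y z = ((x Fin.<? y) ×-dec (y Fin.<? z)) ⊎-dec (((y Fin.<? z) ×-dec (z Fin.<? x)) ⊎-dec ((z Fin.<? x) ×-dec (x Fin.<? y)))

cyc-rotate : {x y z : Fin n} → Cyc x y z → Cyc y z x
cyc-rotate (inj₁ (x<y , y<z))        = inj₂ (inj₂ (x<y , y<z))
cyc-rotate (inj₂ (inj₁ (y<z , z<x))) = inj₁ (y<z , z<x)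
cyc-rotate (inj₂ (inj₂ (z<x , x<y))) = inj₂ (inj₁ (z<x , x<y))

-- With `x` fixed, `Cyc x y z` says that `y` is met before `z` going up cyclically from `x`; this is
-- transitivity of that order, by cases on where the wrap-around falls.
cyc-trans : {x y z t : Fin n} → Cyc x y z → Cyc x z t → Cyc x y t
cyc-trans (inj₁ (x<y , y<z)) (inj₁ (x<z , z<t))               = inj₁ (x<y , ℕ.<-trans y<z z<t)
cyc-trans (inj₁ (x<y , y<z)) (inj₂ (inj₁ (z<t , t<x)))        = ⊥-elim (ℕ.<-asym (ℕ.<-trans x<y y<z) (ℕ.<-trans z<t t<x))
cyc-trans (inj₁ (x<y , y<z)) (inj₂ (inj₂ (t<x , x<z)))        = inj₂ (inj₂ (t<x , x<y))
cyc-trans (inj₂ (inj₁ (y<z , z<x))) (inj₁ (x<z , z<t))        = ⊥-elim (ℕ.<-asym z<x x<z)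
cyc-trans (inj₂ (inj₁ (y<z , z<x))) (inj₂ (inj₁ (z<t , t<x))) = inj₂ (inj₁ (ℕ.<-trans y<z z<t , t<x))
cyc-trans (inj₂ (inj₁ (y<z , z<x))) (inj₂ (inj₂ (t<x , x<z))) = ⊥-elim (ℕ.<-asym z<x x<z)
cyc-trans (inj₂ (inj₂ (z<x , x<y))) (inj₁ (x<z , z<t))        = ⊥-elim (ℕ.<-asym z<x x<z)
cyc-trans (inj₂ (inj₂ (z<x , x<y))) (inj₂ (inj₁ (z<t , t<x))) = inj₂ (inj₂ (t<x , x<y))
cyc-trans (inj₂ (inj₂ (z<x , x<y))) (inj₂ (inj₂ (t<x , x<z))) = ⊥-elim (ℕ.<-asym z<x x<z)

-- The companion with the last argument fixed: the order in which values are met on the way up to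
-- `t`.
cyc-transʳ : {x y z t : Fin n} → Cyc x y t → Cyc y z t → Cyc x z t
cyc-transʳ xyt yzt = cyc-rotate (cyc-trans (cyc-rotate (cyc-rotate xyt)) (cyc-rotate (cyc-rotate yzt)))

cyc-drop : {x y z t : Fin n} → Cyc x y z → Cyc x z t → Cyc y z t
cyc-drop xyz xzt = cyc-rotate (cyc-rotate (cyc-trans (cyc-rotate xzt) (cyc-rotate (cyc-rotate xyz))))

¬cyc-xxz : {x z : Fin n} → ¬ Cyc x x z
¬cyc-xxz (inj₁ (x<x , _))        = ℕ.<-irrefl refl x<x
¬cyc-xxz (inj₂ (inj₁ (x<z , z<x))) = ℕ.<-asym x<z z<x
¬cyc-xxz (inj₂ (inj₂ (_ , x<x))) = ℕ.<-irrefl refl x<x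

¬cyc-xyx : {x y : Fin n} → ¬ Cyc x y x
¬cyc-xyx = ¬cyc-xxz ∘ cyc-rotate ∘ cyc-rotate

cyc-asym : {x y z : Fin n} → Cyc x y z → ¬ Cyc x z y
cyc-asym xyz xzy = ¬cyc-xyx (cyc-rotate (cyc-rotate (cyc-trans xyz xzy)))

cyc-total : {x y z : Fin n} → x ≢ y → y ≢ z → x ≢ z → Cyc x y z ⊎ Cyc x z y
cyc-total {x = x} {y} {z} x≢y y≢z x≢z with Fin.<-cmp x y | Fin.<-cmp y z | Fin.<-cmp x z
... | tri≈ _ x≡y _ | _ | _ = ⊥-elim (x≢y x≡y)
... | _ | tri≈ _ y≡z _ | _ = ⊥-elim (y≢z y≡z)
... | _ | _ | tri≈ _ x≡z _ = ⊥-elim (x≢z x≡z)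
... | tri< x<y _ _ | tri< y<z _ _ | _ = inj₁ (inj₁ (x<y , y<z))
... | tri< x<y _ _ | tri> _ _ z<y | tri< x<z _ _ = inj₂ (inj₁ (x<z , z<y))
... | tri< x<y _ _ | tri> _ _ z<y | tri> _ _ z<x = inj₁ (inj₂ (inj₂ (z<x , x<y)))
... | tri> _ _ y<x | tri< y<z _ _ | tri< x<z _ _ = inj₂ (inj₂ (inj₂ (y<x , x<z)))
... | tri> _ _ y<x | tri< y<z _ _ | tri> _ _ z<x = inj₁ (inj₂ (inj₁ (y<z , z<x)))
... | tri> _ _ y<x | tri> _ _ z<y | _ = inj₂ (inj₂ (inj₁ (z<y , y<x)))

-- A running maximum for the order ending at `v`: the candidate moves to `y` exactly when `f y` lies
-- on its arc to `v`, and this only shrinks the arc.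
closest : (f : Fin n → Fin n) (x : Fin n) (xs : List (Fin n)) (v : Fin n) →
  ∃ λ i → i ∈ x ∷ xs × (∀ {j} → j ∈ x ∷ xs → ¬ Cyc (f i) (f j) v)
closest f x []       v = x , here refl , λ { (here refl) → ¬cyc-xxz }
closest f x (y ∷ ys) v with closest f x ys v
... | i , i∈ , best with Cyc? (f i) (f y) v
...   | yes iyv = y , there (here refl) , λ where
          (here refl)         yjv → best (here refl) (cyc-transʳ iyv yjv)
          (there (here refl)) yjv → ¬cyc-xxz yjv
          (there (there j∈))  yjv → best (there j∈) (cyc-transʳ iyv yjv)
...   | no ¬iyv = i , weaken i∈ , λ where
          (here refl)         → best (here refl)
          (there (here refl)) → ¬iyv
          (there (there j∈))  → best (there j∈)
  where
  weaken : ∀ {i} → i ∈ x ∷ ys → i ∈ x ∷ y ∷ ys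
  weaken (here i≡x) = here i≡x
  weaken (there i∈) = there (there i∈)

-- The greedy choice: `v` is the first element met going up cyclically from `x`, where `x` itself,
-- if present, comes first.
first-from : (x y : Fin n) (ys : List (Fin n)) → Unique (y ∷ ys) →
  ∃₂ λ v S → y ∷ ys ↭ v ∷ S × (∀ {z} → z ∈ S → ¬ Cyc x z v × z ≢ x)
first-from x y []       _ = y , [] , ↭-refl , λ ()
first-from x y (z ∷ zs) (y∉ ∷ uniq) with first-from x z zs uniq
... | v , S , perm , best = go
  where
  y≢ : ∀ {t} → t ∈ v ∷ S → y ≢ t
  y≢ t∈ = All.lookup y∉ (∈-resp-↭ (↭-sym perm) t∈)
  keep : ¬ Cyc x y v × y ≢ x → ∃₂ λ v S → y ∷ z ∷ zs ↭ v ∷ S × (∀ {z} → z ∈ S → ¬ Cyc x z v × z ≢ x)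
  keep ok = v , y ∷ S , ↭-trans (prep y perm) (↭.swap y v ↭-refl) , λ where
    (here refl) → ok
    (there t∈)  → best t∈
  take-y : (∀ {t} → t ∈ v ∷ S → ¬ Cyc x t y × t ≢ x) →
    ∃₂ λ v S → y ∷ z ∷ zs ↭ v ∷ S × (∀ {z} → z ∈ S → ¬ Cyc x z v × z ≢ x)
  take-y ok = y , v ∷ S , prep y perm , ok
  go : ∃₂ λ v S → y ∷ z ∷ zs ↭ v ∷ S × (∀ {z} → z ∈ S → ¬ Cyc x z v × z ≢ x)
  go with v Fin.≟ x | y Fin.≟ x | Cyc? x y v
  ... | yes refl | _        | _       = keep (¬cyc-xyx , y≢ (here refl))
  ... | no _     | yes refl | _       = take-y λ t∈ → ¬cyc-xyx , ≢-sym (y≢ t∈)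
  ... | no v≢x   | no _     | yes xyv = take-y λ where
          (here refl) → cyc-asym xyv , v≢x
          (there t∈)  → (λ xty → proj₁ (best t∈) (cyc-trans xty xyv)) , proj₂ (best t∈)
  ... | no _     | no y≢x   | no ¬xyv = keep (¬xyv , y≢x)

-- Paths along one row of Γ(k)

Path-++⁺ : ∀ {w v u : Perm n} {βs γs J K} → Path w βs J v → Path v γs K u → Path w (βs ++ γs) (J ++ K) u
Path-++⁺ done            path = path
Path-++⁺ (skip path₁)    path = skip (Path-++⁺ path₁ path)
Path-++⁺ (fold edge path₁) path = fold edge (Path-++⁺ path₁ path)

Path-++⁻ : ∀ {w u : Perm n} βs {γs L} → Path w (βs ++ γs) L u →
  ∃ λ v → ∃₂ λ J K → L ≡ J ++ K × Path w βs J v × Path v γs K u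
Path-++⁻ [] path = _ , [] , _ , refl , done , path
Path-++⁻ (β ∷ βs) (skip path) with v , J , K , refl , path₁ , path₂ ← Path-++⁻ βs path =
  v , false ∷ J , K , refl , skip path₁ , path₂
Path-++⁻ (β ∷ βs) (fold edge path) with v , J , K , refl , path₁ , path₂ ← Path-++⁻ βs path =
  v , true ∷ J , K , refl , fold edge path₁ , path₂

Agree-off : List (Fin n) → Perm n → Perm n → Set
Agree-off A w u = ∀ i → i ∉ A → lookup w i ≡ lookup u i

module _ {n : ℕ} where
  open import Data.List.Membership.DecPropositional (Fin._≟_ {n}) public using (_∈?_)

-- If a value of `w` on `A` occurred in `u` outside `A`, agreement there would make `w` take it
-- twice.
transfer : ∀ (A : List (Fin n)) (w u : Perm n) → IsPerm w → IsPerm u → Agree-off A w u →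
  ∀ i → i ∈ A → ∃ λ j → j ∈ A × lookup w i ≡ lookup u j
transfer A w u w-perm u-perm agree i i∈A with perm-surjective u u-perm (lookup w i)
... | j , uj≡wi with j ∈? A
...   | yes j∈A = j , j∈A , sym uj≡wi
...   | no j∉A with refl ← w-perm j i (trans (agree j j∉A) uj≡wi) = ⊥-elim (j∉A i∈A)

-- An initial segment, listed decreasingly, of the positions ≥ h.
data Down {n} (h : ℕ) : List (Fin n) → Set where
  []   : Down h []
  cons : ∀ {b bs} → h ≤ toℕ b → (∀ {i} → h ≤ toℕ i → i Fin.< b → i ∈ bs) → (∀ {i} → i ∈ bs → i Fin.< b) →
         Down h bs → Down h (b ∷ bs)

Down-≥ : ∀ {h} {bs : List (Fin n)} → Down h bs → ∀ {i} → i ∈ bs → h ≤ toℕ i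
Down-≥ (cons h≤b _ _ _)    (here refl) = h≤b
Down-≥ (cons _   _ _ down) (there i∈)  = Down-≥ down i∈

row : Fin n → List (Fin n) → List (Root n)
row a = map (a ,_)

module _ {h : ℕ} (a : Fin n) (a<h : toℕ a < h) where

  row-positive : ∀ {bs} → Down h bs → All Positive (row a bs)
  row-positive down = All.map⁺ (All.tabulate λ i∈ → ℕ.<-≤-trans a<h (Down-≥ down i∈))

  row-isPerm : ∀ {bs w u J} → Down h bs → Path w (row a bs) J u → IsPerm u → IsPerm w
  row-isPerm {w = w} down path = Path-isPerm {w = w} (row-positive down) path

  row-agree : ∀ {bs w u J} → Path w (row a bs) J u → Agree-off (a ∷ bs) w u
  row-agree {[]} done i i∉ = refl
  row-agree {b ∷ bs} (skip path) i i∉ = row-agree path i λ { (here e) → i∉ (here e) ; (there e) → i∉ (there (there e)) }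
  row-agree {b ∷ bs} {w} (fold _ path) i i∉ =
    trans (sym (lookup-swap-≢ w (λ e → i∉ (here e)) (λ e → i∉ (there (here e)))))
          (row-agree path i λ { (here e) → i∉ (here e) ; (there e) → i∉ (there (there e)) })

  private
    inner∉ : ∀ {bs i} → Down h bs → a Fin.< i → toℕ i < h → i ∉ a ∷ bs
    inner∉ down a<i i<h (here refl) = ℕ.<-irrefl refl a<i
    inner∉ down a<i i<h (there i∈) = ℕ.<-irrefl refl (ℕ.<-≤-trans i<h (Down-≥ down i∈))

    b∉ : ∀ {b bs} → h ≤ toℕ b → (∀ {i} → i ∈ bs → i Fin.< b) → b ∉ a ∷ bs
    b∉ h≤b <b (here refl) = ℕ.<-irrefl refl (ℕ.<-≤-trans a<h h≤b)
    b∉ h≤b <b (there b∈) = ℕ.<-irrefl refl (<b b∈)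

  -- Positions strictly between `a` and `h` keep their entries along the row. After a first fold at
  -- `b` the entry at `a` is w(b), which cuts the arc from u(a) to w(a): the part up to w(b) is
  -- excluded by induction, the part from w(b) to w(a) by the edge condition.
  row-¬cyc : ∀ {bs w u J} → Down h bs → IsPerm u → Path w (row a bs) J u →
    ∀ i → a Fin.< i → toℕ i < h → ¬ Cyc (lookup u a) (lookup u i) (lookup w a)
  row-¬cyc {[]} _ _ done i a<i i<h = ¬cyc-xyx
  row-¬cyc {b ∷ bs} {w} (cons _ _ _ down) u-perm (skip path) = row-¬cyc {w = w} down u-perm path
  row-¬cyc {b ∷ bs} {w} {u} down′@(cons h≤b _ _ down) u-perm (fold edge path) i a<i i<h cyc
    with transfer (a ∷ bs) v u (row-isPerm {w = v} down path u-perm) u-perm (row-agree path) a (here refl)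
    where v = swap w a b
  ... | j , j∈ , va≡uj with lookup u a Fin.≟ lookup w b
  ...   | yes ua≡wb = edge i a<i (ℕ.<-≤-trans i<h h≤b) (subst₂ (λ x y → Cyc x y (lookup w a)) ua≡wb (sym wi≡ui) cyc)
    where wi≡ui = row-agree {b ∷ bs} {w} (fold edge path) i (inner∉ down′ a<i i<h)
  ...   | no ua≢wb with cyc-total {x = lookup u a} {lookup u i} {lookup w b} ua≢ui ui≢wb ua≢wb
    where
    ua≢ui : lookup u a ≢ lookup u i
    ua≢ui e = Fin.<⇒≢ a<i (u-perm a i e)
    ui≢wb : lookup u i ≢ lookup w b
    ui≢wb e with refl ← u-perm i j (trans e (trans (sym (lookup-swapˡ w (Fin.<⇒≢ (ℕ.<-≤-trans a<h h≤b)))) va≡uj)) =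
      inner∉ down a<i i<h j∈
  ...     | inj₁ cyc′ = row-¬cyc {w = swap w a b} down u-perm path i a<i i<h
                          (subst (Cyc (lookup u a) (lookup u i)) (sym (lookup-swapˡ w (Fin.<⇒≢ (ℕ.<-≤-trans a<h h≤b)))) cyc′)
  ...     | inj₂ cyc′ = edge i a<i (ℕ.<-≤-trans i<h h≤b)
                          (subst (λ y → Cyc (lookup w b) y (lookup w a)) (sym wi≡ui) (cyc-drop cyc′ cyc))
    where wi≡ui = row-agree {b ∷ bs} {w} (fold edge path) i (inner∉ down′ a<i i<h)

  -- If v sits at the top position b of the row, the last fold must bring it to a, so the entry
  -- at a just before must be the cyclically closest predecessor of v in the row.
  row-exists : ∀ {bs} (u : Perm n) → Down h bs → IsPerm u → ∀ v →
    (∃ λ i → i ∈ a ∷ bs × lookup u i ≡ v) → (∀ i → a Fin.< i → toℕ i < h → ¬ Cyc (lookup u a) (lookup u i) v) →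
    ∃₂ λ w J → Path w (row a bs) J u × lookup w a ≡ v
  row-exists u [] u-perm v (_ , here refl , ua≡v) _ = u , [] , done , ua≡v
  row-exists u (cons _ _ _ down) u-perm v (i , here refl , ui≡v) ok
    with w , J , path , eq ← row-exists u down u-perm v (i , here refl , ui≡v) ok = w , false ∷ J , skip path , eq
  row-exists u (cons _ _ _ down) u-perm v (i , there (there i∈) , ui≡v) ok
    with w , J , path , eq ← row-exists u down u-perm v (i , there i∈ , ui≡v) ok = w , false ∷ J , skip path , eq
  row-exists {b ∷ bs} u (cons h≤b fill <b down) u-perm .(lookup u b) (.b , there (here refl) , refl) ok
    with closest (lookup u) a bs (lookup u b)
  ... | k , k∈ , best = build (row-exists u down u-perm (lookup u k) (k , k∈ , refl) ok′)
    where
    v = lookup u b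
    a≢b : a ≢ b
    a≢b = Fin.<⇒≢ (ℕ.<-≤-trans a<h h≤b)
    ≢v : ∀ {i} → i ∈ a ∷ bs → lookup u i ≢ v
    ≢v {i} i∈ e with refl ← u-perm i b e = b∉ h≤b <b i∈
    -- Otherwise u(a) would lie on the arc from u(k) up to `v`, against the choice of `k`.
    a-k-v : lookup u a ≡ lookup u k ⊎ Cyc (lookup u a) (lookup u k) v
    a-k-v with lookup u a Fin.≟ lookup u k
    ... | yes eq = inj₁ eq
    ... | no ua≢uk with cyc-total {x = lookup u a} {lookup u k} {v} ua≢uk (≢v k∈) (≢v (here refl))
    ...   | inj₁ c = inj₂ c
    ...   | inj₂ c = ⊥-elim (best (here refl) (cyc-rotate (cyc-rotate c)))
    ok′ : ∀ i → a Fin.< i → toℕ i < h → ¬ Cyc (lookup u a) (lookup u i) (lookup u k)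
    ok′ i a<i i<h c with a-k-v
    ... | inj₁ eq rewrite eq = ¬cyc-xyx c
    ... | inj₂ c′ = ok i a<i i<h (cyc-trans c c′)
    build : (∃₂ λ w J → Path w (row a bs) J u × lookup w a ≡ lookup u k) →
            ∃₂ λ w J → Path w (row a (b ∷ bs)) J u × lookup w a ≡ v
    build (w₁ , J , path , w₁a≡uk) = w , true ∷ J , fold edge (subst (λ x → Path x (row a bs) J u) (sym (swap-involutive w₁ a≢b)) path) , wa≡v
      where
      w = swap w₁ a b
      w₁-perm : IsPerm w₁
      w₁-perm = row-isPerm {w = w₁} down path u-perm
      wa≡v : lookup w a ≡ v
      wa≡v = trans (lookup-swapˡ w₁ a≢b) (row-agree path b (b∉ h≤b <b))
      -- Positions from `h` on hold entries permuted within the rest of the row, excluded by the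
      -- choice of `k`; positions below `h` are untouched, and `ok` excludes them because the arc
      -- from u(k) to `v` is part of the arc from u(a).
      inside : ∀ i → a Fin.< i → i Fin.< b → ¬ Cyc (lookup u k) (lookup w₁ i) v
      inside i a<i i<b c with toℕ i <? h
      ... | no i≮h with j , j∈ , eq ← transfer (a ∷ bs) w₁ u w₁-perm u-perm (row-agree path) i (there (fill (ℕ.≮⇒≥ i≮h) i<b)) =
        best j∈ (subst (λ y → Cyc (lookup u k) y v) eq c)
      ... | yes i<h = bad (subst (λ y → Cyc (lookup u k) y v) (row-agree path i (inner∉ down a<i i<h)) c)
        where
        bad : ¬ Cyc (lookup u k) (lookup u i) v
        bad c with a-k-v
        ... | inj₁ eq = ok i a<i i<h (subst (λ x → Cyc x (lookup u i) v) (sym eq) c)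
        ... | inj₂ c′ = ok i a<i i<h (cyc-transʳ c′ c)
      edge : Edge w a b
      edge i a<i i<b c = inside i a<i i<b
        (subst₂ (λ x y → Cyc x y v) (trans (lookup-swapʳ w₁) w₁a≡uk)
          (lookup-swap-≢ w₁ (≢-sym (Fin.<⇒≢ a<i)) (Fin.<⇒≢ i<b)) (subst (Cyc (lookup w b) (lookup w i)) wa≡v c))

  private
    -- A fold at `b` leaves x(a) at position `b` for good, so x(a) = u(b); after a skip w(a) ends up
    -- in `a ∷ bs`, which omits `b`. The entry at `a` thus reveals the choice made at `b`.
    skip≢fold : ∀ {b bs w x u J K} → Down h (b ∷ bs) → IsPerm u →
      Path w (row a bs) J u → Path (swap x a b) (row a bs) K u → lookup w a ≢ lookup x a
    skip≢fold {b} {bs} {w} {x} {u} (cons h≤b _ <b down) u-perm path path′ wa≡xa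
      with j , j∈ , wa≡uj ← transfer (a ∷ bs) w u (row-isPerm {w = w} down path u-perm) u-perm (row-agree path) a (here refl)
      with refl ← u-perm b j (trans (sym (row-agree path′ b (b∉ h≤b <b))) (trans (lookup-swapʳ x) (trans (sym wa≡xa) wa≡uj)))
      = b∉ h≤b <b j∈

    -- Through the common end `u`, the value x(b) occurs in `swap w a b` at some position of
    -- `a ∷ bs`. At `a` it would equal w(b); in `bs` it is strictly between `a` and `b`, where the
    -- edge condition keeps it off the arc.
    ¬cyc-fold : ∀ {b bs w x u J K} → Down h (b ∷ bs) → IsPerm u → Edge w a b →
      Path (swap w a b) (row a bs) J u → Path (swap x a b) (row a bs) K u → lookup w b ≢ lookup x b →
      ¬ Cyc (lookup w b) (lookup x b) (lookup w a)
    ¬cyc-fold {b} {bs} {w} {x} {u} (cons h≤b _ <b down) u-perm edge path path′ wb≢xb cyc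
      with j , j∈ , x₁a≡uj ← transfer (a ∷ bs) (swap x a b) u (row-isPerm {w = swap x a b} down path′ u-perm) u-perm (row-agree path′) a (here refl)
      with k , k∈ , uj≡w₁k ← transfer (a ∷ bs) u (swap w a b) u-perm (row-isPerm {w = swap w a b} down path u-perm) (λ i i∉ → sym (row-agree path i i∉)) j j∈
      = absurd k∈ (trans (sym (lookup-swapˡ x a≢b)) (trans x₁a≡uj uj≡w₁k))
      where
      a≢b : a ≢ b
      a≢b = Fin.<⇒≢ (ℕ.<-≤-trans a<h h≤b)
      absurd : ∀ {k} → k ∈ a ∷ bs → lookup x b ≡ lookup (swap w a b) k → ⊥
      absurd (here refl) eq = wb≢xb (sym (trans eq (lookup-swapˡ w a≢b)))
      absurd {k} (there k∈) eq = edge k a<k (<b k∈) (subst (λ y → Cyc (lookup w b) y (lookup w a)) (trans eq w₁k≡wk) cyc)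
        where
        a<k = ℕ.<-≤-trans a<h (Down-≥ down k∈)
        w₁k≡wk = lookup-swap-≢ w (≢-sym (Fin.<⇒≢ a<k)) (Fin.<⇒≢ (<b k∈))

  -- The choices at the head agree by `skip≢fold`. If both fold and w(b), x(b) differ, one lies on
  -- the arc from the other up to the common entry at `a`, against `¬cyc-fold`.
  row-unique : ∀ {bs w x u J K} → Down h bs → IsPerm u → Path w (row a bs) J u → Path x (row a bs) K u →
    lookup w a ≡ lookup x a → w ≡ x × J ≡ K
  row-unique {[]} _ _ done done _ = refl , refl
  row-unique {b ∷ bs} {w} {x} (cons _ _ _ down) u-perm (skip path) (skip path′) wa≡xa
    with refl , refl ← row-unique {w = w} {x} down u-perm path path′ wa≡xa = refl , refl
  row-unique {b ∷ bs} {w} {x} down u-perm (skip path) (fold _ path′) wa≡xa = ⊥-elim (skip≢fold {w = w} {x} down u-perm path path′ wa≡xa)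
  row-unique {b ∷ bs} {w} {x} down u-perm (fold _ path) (skip path′) wa≡xa = ⊥-elim (skip≢fold {w = x} {w} down u-perm path′ path (sym wa≡xa))
  row-unique {b ∷ bs} {w} {x} {u} down′@(cons h≤b _ <b down) u-perm (fold edge path) (fold edge′ path′) wa≡xa =
    combine (row-unique {w = swap w a b} {swap x a b} down u-perm path path′
      (trans (lookup-swapˡ w a≢b) (trans wb≡xb (sym (lookup-swapˡ x a≢b)))))
    where
    a≢b : a ≢ b
    a≢b = Fin.<⇒≢ (ℕ.<-≤-trans a<h h≤b)
    perm-of : ∀ {y K} → Path (swap y a b) (row a bs) K u → IsPerm y
    perm-of {y} p = subst IsPerm (swap-involutive y a≢b) (swap-isPerm (swap y a b) a≢b (row-isPerm {w = swap y a b} down p u-perm))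
    wb≡xb : lookup w b ≡ lookup x b
    wb≡xb with lookup w b Fin.≟ lookup x b
    ... | yes eq = eq
    ... | no wb≢xb with cyc-total {x = lookup w b} {lookup x b} {lookup w a} wb≢xb
                     (λ e → a≢b (sym (perm-of {x} path′ b a (trans e wa≡xa)))) (λ e → a≢b (sym (perm-of {w} path b a e)))
    ...   | inj₁ c = ⊥-elim (¬cyc-fold {w = w} {x} down′ u-perm edge path path′ wb≢xb c)
    ...   | inj₂ c = ⊥-elim (¬cyc-fold {w = x} {w} down′ u-perm edge′ path′ path (≢-sym wb≢xb)
                       (subst (Cyc (lookup x b) (lookup w b)) wa≡xa (cyc-rotate (cyc-rotate c))))
    combine : ∀ {J K} → swap w a b ≡ swap x a b × J ≡ K → w ≡ x × true ∷ J ≡ true ∷ K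
    combine (eq , refl) = trans (sym (swap-involutive w a≢b)) (trans (cong (λ y → swap y a b) eq) (swap-involutive x a≢b)) , refl

-- Paths along a block Γ(k)

Unique-resp-↭ : {xs ys : List A} → xs ↭ ys → Unique xs → Unique ys
Unique-resp-↭ {A} xs↭ys = ↭ₛ.Unique-resp-↭ (setoid A) (↭⇒↭ₛ xs↭ys)

-- A final segment, listed increasingly, of the positions < h.
data Up {n} (h : ℕ) : List (Fin n) → Set where
  []   : Up h []
  cons : ∀ {a as} → toℕ a < h → (∀ {i} → a Fin.< i → toℕ i < h → i ∈ as) → (∀ {i} → i ∈ as → a Fin.< i) →
         Up h as → Up h (a ∷ as)

Up-< : ∀ {h} {as : List (Fin n)} → Up h as → ∀ {i} → i ∈ as → toℕ i < h
Up-< (cons a<h _ _ _)  (here refl) = a<h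
Up-< (cons _ _ _ up)   (there i∈)  = Up-< up i∈

module _ {h : ℕ} {bs : List (Fin n)} (down : Down h bs) (all∈ : ∀ {i} → h ≤ toℕ i → i ∈ bs) where

  rows : List (Fin n) → List (Root n)
  rows = concatMap (λ a → row a bs)

  rows-positive : ∀ {as} → Up h as → All Positive (rows as)
  rows-positive []                  = []
  rows-positive (cons a<h _ _ up) = All.++⁺ (row-positive _ a<h down) (rows-positive up)

  private
    off-row : ∀ {a i} → i ≢ a → toℕ i < h → i ∉ a ∷ bs
    off-row i≢a i<h (here i≡a)  = i≢a i≡a
    off-row i≢a i<h (there i∈)  = ℕ.<-irrefl refl (ℕ.<-≤-trans i<h (Down-≥ down i∈))

  rows-agree : ∀ {as w u J} → Up h as → Path w (rows as) J u → ∀ {i} → i ∉ as → toℕ i < h → lookup w i ≡ lookup u i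
  rows-agree [] done _ _ = refl
  rows-agree {a ∷ as} (cons a<h _ _ up) path i∉ i<h
    with v , J , K , refl , path₁ , path₂ ← Path-++⁻ (row a bs) path =
    trans (row-agree a a<h path₁ _ (off-row (i∉ ∘ here) i<h)) (rows-agree up path₂ (i∉ ∘ there) i<h)

  -- The set of entries in the rows pins down the entry at `a`. Removing it leaves the same
  -- condition for the later rows, which agree by induction, and `row-unique` settles the row of
  -- `a`.
  rows-unique : ∀ {as w x u J K} → Up h as → IsPerm u → Path w (rows as) J u → Path x (rows as) K u →
    map (lookup w) as ↭ map (lookup x) as → w ≡ x × J ≡ K
  rows-unique [] _ done done _ = refl , refl
  rows-unique {a ∷ as} {w} {x} {u} (cons a<h mid∈ a< up) u-perm path path′ perm
    with v , J₁ , J₂ , refl , path₁ , path₂ ← Path-++⁻ (row a bs) path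
    with y , K₁ , K₂ , refl , path₁′ , path₂′ ← Path-++⁻ (row a bs) path′ = combine (rows-unique up u-perm path₂ path₂′ tails)
    where
    v-perm : IsPerm v
    v-perm = Path-isPerm {w = v} (rows-positive up) path₂ u-perm
    y-perm : IsPerm y
    y-perm = Path-isPerm {w = y} (rows-positive up) path₂′ u-perm
    a∉ : a ∉ as
    a∉ a∈ = ℕ.<-irrefl refl (a< a∈)
    va≡ua : lookup v a ≡ lookup u a
    va≡ua = rows-agree up path₂ a∉ a<h
    ya≡ua : lookup y a ≡ lookup u a
    ya≡ua = rows-agree up path₂′ a∉ a<h
    wi≡vi : ∀ {i} → i ∈ as → lookup w i ≡ lookup v i
    wi≡vi i∈ = row-agree a a<h path₁ _ (off-row (≢-sym (Fin.<⇒≢ (a< i∈))) (Up-< up i∈))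
    xi≡yi : ∀ {i} → i ∈ as → lookup x i ≡ lookup y i
    xi≡yi i∈ = row-agree a a<h path₁′ _ (off-row (≢-sym (Fin.<⇒≢ (a< i∈))) (Up-< up i∈))
    elsewhere : ∀ {p q : Fin n} {ps qs} → p ≢ q → p ∷ ps ↭ q ∷ qs → p ∈ qs
    elsewhere p≢q perm with ∈-resp-↭ perm (here refl)
    ... | here p≡q = ⊥-elim (p≢q p≡q)
    ... | there p∈ = p∈
    -- Each of w(a), x(a) lies among the other run's entries in the rows below, so neither may
    -- strictly precede the other in the cyclic order starting at u(a).
    wa≡xa : lookup w a ≡ lookup x a
    wa≡xa with lookup w a Fin.≟ lookup x a
    ... | yes eq = eq
    ... | no wa≢xa
      with i , i∈ , wa≡xi ← ∈-map⁻ (lookup x) (elsewhere wa≢xa perm)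
         | j , j∈ , xa≡wj ← ∈-map⁻ (lookup w) (elsewhere (≢-sym wa≢xa) (↭-sym perm))
      with cyc-total {x = lookup u a} {lookup w a} {lookup x a} ua≢wa wa≢xa ua≢xa
      where
      ua≢wa : lookup u a ≢ lookup w a
      ua≢wa e = Fin.<⇒≢ (a< i∈) (y-perm a i (trans ya≡ua (trans e (trans wa≡xi (xi≡yi i∈)))))
      ua≢xa : lookup u a ≢ lookup x a
      ua≢xa e = Fin.<⇒≢ (a< j∈) (v-perm a j (trans va≡ua (trans e (trans xa≡wj (wi≡vi j∈)))))
    ...   | inj₁ c = ⊥-elim (row-¬cyc a a<h {w = x} down y-perm path₁′ i (a< i∈) (Up-< up i∈)
                       (subst₂ (λ p q → Cyc p q (lookup x a)) (sym ya≡ua) (trans wa≡xi (xi≡yi i∈)) c))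
    ...   | inj₂ c = ⊥-elim (row-¬cyc a a<h {w = w} down v-perm path₁ j (a< j∈) (Up-< up j∈)
                       (subst₂ (λ p q → Cyc p q (lookup w a)) (sym va≡ua) (trans xa≡wj (wi≡vi j∈)) c))
    tails : map (lookup v) as ↭ map (lookup y) as
    tails = subst₂ _↭_ (List.map-cong-local (All.tabulate wi≡vi)) (List.map-cong-local (All.tabulate xi≡yi))
      (drop-∷ (subst (λ z → z ∷ map (lookup w) as ↭ map (lookup x) (a ∷ as)) wa≡xa perm))
    combine : v ≡ y × J₂ ≡ K₂ → w ≡ x × J₁ ++ J₂ ≡ K₁ ++ K₂
    combine (refl , refl) with refl , refl ← row-unique a a<h {w = w} {x} down v-perm path₁ path₁′ wa≡xa = refl , refl

  -- The value for row `a` is the first element `t` met from u(a); the remaining set goes to the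
  -- later rows, none of whose entries then lies on the arc from u(a) to `t`. The disjointness
  -- hypothesis keeps entries of rows already passed out of the set.
  rows-exists : ∀ {as} (u : Perm n) (S : List (Fin n)) → Up h as → IsPerm u → Unique S → length S ≡ length as →
    (∀ {i} → i ∉ as → toℕ i < h → lookup u i ∉ S) →
    ∃₂ λ w J → Path w (rows as) J u × map (lookup w) as ↭ S
  rows-exists u [] [] _ _ _ _ = u , [] , done , ↭-refl
  rows-exists {a ∷ as} u (s ∷ ss) (cons a<h mid∈ a< up) u-perm uniq len disjoint
    with t , S , perm , best ← first-from (lookup u a) s ss uniq
    with t∉ ∷ uniq′ ← Unique-resp-↭ perm uniq
    = extend (rows-exists u S up u-perm uniq′ (ℕ.suc-injective (trans (sym (↭-length perm)) len)) disjoint′)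
    where
    a∉ : a ∉ as
    a∉ a∈ = ℕ.<-irrefl refl (a< a∈)
    disjoint′ : ∀ {i} → i ∉ as → toℕ i < h → lookup u i ∉ S
    disjoint′ {i} i∉ i<h ui∈ with i Fin.≟ a
    -- Had u(a) been in the set, it would itself have been chosen as `t`.
    ... | yes refl = proj₂ (best ui∈) refl
    ... | no i≢a = disjoint (λ { (here i≡a) → i≢a i≡a ; (there i∈) → i∉ i∈ }) i<h (∈-resp-↭ (↭-sym perm) (there ui∈))
    extend : (∃₂ λ v K → Path v (rows as) K u × map (lookup v) as ↭ S) →
      ∃₂ λ w J → Path w (rows (a ∷ as)) J u × map (lookup w) (a ∷ as) ↭ s ∷ ss
    extend (v , K , path₂ , v↭S) = build (row-exists a a<h v down v-perm t t-avail t-ok)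
      where
      v-perm : IsPerm v
      v-perm = Path-isPerm {w = v} (rows-positive up) path₂ u-perm
      vi∈S : ∀ {i} → i ∈ as → lookup v i ∈ S
      vi∈S i∈ = ∈-resp-↭ v↭S (∈-map⁺ (lookup v) i∈)
      t-ok : ∀ i → a Fin.< i → toℕ i < h → ¬ Cyc (lookup v a) (lookup v i) t
      t-ok i a<i i<h c = proj₁ (best (vi∈S (mid∈ a<i i<h))) (subst (λ p → Cyc p (lookup v i) t) (rows-agree up path₂ a∉ a<h) c)
      -- `t` cannot sit in a later row, since these hold `S` without `t`, nor in an earlier one, by
      -- disjointness.
      t-avail : ∃ λ i → i ∈ a ∷ bs × lookup v i ≡ t
      t-avail with i , vi≡t ← perm-surjective v v-perm t with i Fin.≟ a | toℕ i <? h
      ... | yes i≡a | _      = i , here i≡a , vi≡t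
      ... | no _    | no i≮h = i , there (all∈ (ℕ.≮⇒≥ i≮h)) , vi≡t
      ... | no i≢a  | yes i<h with i ∈? as
      ...   | yes i∈ = ⊥-elim (All.lookup t∉ (vi∈S i∈) (sym vi≡t))
      ...   | no i∉  = ⊥-elim (disjoint (λ { (here i≡a) → i≢a i≡a ; (there i∈) → i∉ i∈ }) i<h
                         (subst (_∈ s ∷ ss) (trans (sym vi≡t) (rows-agree up path₂ i∉ i<h)) (∈-resp-↭ (↭-sym perm) (here refl))))
      build : (∃₂ λ w J → Path w (row a bs) J v × lookup w a ≡ t) →
        ∃₂ λ w J → Path w (rows (a ∷ as)) J u × map (lookup w) (a ∷ as) ↭ s ∷ ss
      build (w , J , path₁ , wa≡t) = w , J ++ K , Path-++⁺ path₁ path₂ ,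
        ↭-trans (↭-trans (↭-reflexive (cong₂ _∷_ wa≡t (List.map-cong-local (All.tabulate wi≡vi)))) (prep t v↭S)) (↭-sym perm)
        where
        wi≡vi : ∀ {i} → i ∈ as → lookup w i ≡ lookup v i
        wi≡vi i∈ = row-agree a a<h path₁ _ (off-row (≢-sym (Fin.<⇒≢ (a< i∈))) (Up-< up i∈))

-- Ordered positions of a block, and its column as a prefix

tops : (n h : ℕ) → List (Fin n)
tops n h = filter (λ a → toℕ a <? h) (allFin n)

bottoms : (n h : ℕ) → List (Fin n)
bottoms n h = filter (λ b → h ≤? toℕ b) (reverse (allFin n))

-- Completeness is phrased so as to pass to tails: a position below `h` is listed or precedes
-- everything listed.
ascending⇒Up : ∀ {h} {as : List (Fin n)} → AllPairs Fin._<_ as → All (λ a → toℕ a < h) as →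
  (∀ i → toℕ i < h → i ∈ as ⊎ All (i Fin.<_) as) → Up h as
ascending⇒Up [] _ _ = []
ascending⇒Up {n} {h} {a ∷ as} (a<as ∷ asc) (a<h ∷ as<h) complete = cons a<h mid∈ (All.lookup a<as) (ascending⇒Up asc as<h complete′)
  where
  mid∈ : ∀ {i} → a Fin.< i → toℕ i < h → i ∈ as
  mid∈ {i} a<i i<h with complete i i<h
  ... | inj₁ (here refl) = ⊥-elim (ℕ.<-irrefl refl a<i)
  ... | inj₁ (there i∈)  = i∈
  ... | inj₂ (i<a ∷ _)   = ⊥-elim (ℕ.<-asym a<i i<a)
  complete′ : ∀ i → toℕ i < h → i ∈ as ⊎ All (i Fin.<_) as
  complete′ i i<h with complete i i<h
  ... | inj₁ (here refl)  = inj₂ a<as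
  ... | inj₁ (there i∈)   = inj₁ i∈
  ... | inj₂ (_ ∷ i<as)   = inj₂ i<as

descending⇒Down : ∀ {h} {bs : List (Fin n)} → AllPairs Fin._>_ bs → All (λ b → h ≤ toℕ b) bs →
  (∀ i → h ≤ toℕ i → i ∈ bs ⊎ All (i Fin.>_) bs) → Down h bs
descending⇒Down [] _ _ = []
descending⇒Down {n} {h} {b ∷ bs} (b>bs ∷ desc) (h≤b ∷ h≤bs) complete = cons h≤b low∈ (All.lookup b>bs) (descending⇒Down desc h≤bs complete′)
  where
  low∈ : ∀ {i} → h ≤ toℕ i → i Fin.< b → i ∈ bs
  low∈ {i} h≤i i<b with complete i h≤i
  ... | inj₁ (here refl) = ⊥-elim (ℕ.<-irrefl refl i<b)
  ... | inj₁ (there i∈)  = i∈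
  ... | inj₂ (i>b ∷ _)   = ⊥-elim (ℕ.<-asym i>b i<b)
  complete′ : ∀ i → h ≤ toℕ i → i ∈ bs ⊎ All (i Fin.>_) bs
  complete′ i h≤i with complete i h≤i
  ... | inj₁ (here refl)  = inj₂ b>bs
  ... | inj₁ (there i∈)   = inj₁ i∈
  ... | inj₂ (_ ∷ i>bs)   = inj₂ i>bs

AllPairs-reverse : {R : A → A → Set} {xs : List A} → AllPairs R xs → AllPairs (λ x y → R y x) (reverse xs)
AllPairs-reverse [] = []
AllPairs-reverse {xs = x ∷ xs} (px ∷ pxs) rewrite List.unfold-reverse x xs =
  AllPairs.++⁺ (AllPairs-reverse pxs) ([] ∷ []) (All.tabulate λ y∈ → All.lookup px (Any.reverse⁻ y∈) ∷ [])

∈-tops : ∀ {h} {i : Fin n} → toℕ i < h → i ∈ tops n h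
∈-tops {h = h} {i} i<h = ∈-filter⁺ (λ a → toℕ a <? h) (∈-allFin i) i<h

∈-bottoms : ∀ {h} {i : Fin n} → h ≤ toℕ i → i ∈ bottoms n h
∈-bottoms {h = h} {i} h≤i = ∈-filter⁺ (λ b → h ≤? toℕ b) (Any.reverse⁺ (∈-allFin i)) h≤i

tops-Up : ∀ n h → Up h (tops n h)
tops-Up n h = ascending⇒Up (AllPairs.filter⁺ _ (AllPairs.tabulate⁺-< id)) (All.all-filter _ (allFin n)) (λ i i<h → inj₁ (∈-tops i<h))

bottoms-Down : ∀ n h → Down h (bottoms n h)
bottoms-Down n h = descending⇒Down (AllPairs.filter⁺ _ (AllPairs-reverse (AllPairs.tabulate⁺-< id)))
  (All.all-filter _ (reverse (allFin n))) (λ i h≤i → inj₁ (∈-bottoms h≤i))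

filter-map-suc : ∀ h (xs : List (Fin n)) →
  filter (λ a → toℕ a <? suc h) (map suc xs) ≡ map suc (filter (λ a → toℕ a <? h) xs)
filter-map-suc h [] = refl
filter-map-suc h (x ∷ xs) with toℕ x ℕ.<ᵇ h
... | true  = cong (suc x ∷_) (filter-map-suc h xs)
... | false = filter-map-suc h xs

-- Links the filter defining the rows of Γ(h) with the prefix defining a column.
tops≡take : ∀ n h → tops n h ≡ take h (allFin n)
tops≡take n       zero    = List.filter-none (λ a → toℕ a <? 0) {xs = allFin n} (All.tabulate λ _ ())
tops≡take zero    (suc h) = refl
tops≡take (suc n) (suc h) = cong (zero ∷_) (begin
  filter (λ a → toℕ a <? suc h) (tabulate suc)         ≡⟨ cong (filter (λ a → toℕ a <? suc h)) (sym (List.map-tabulate id suc)) ⟩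
  filter (λ a → toℕ a <? suc h) (map suc (allFin n))   ≡⟨ filter-map-suc h (allFin n) ⟩
  map suc (tops n h)                                   ≡⟨ cong (map suc) (tops≡take n h) ⟩
  map suc (take h (allFin n))                          ≡⟨ sym (List.take-map h (allFin n)) ⟩
  take h (map suc (allFin n))                          ≡⟨ cong (take h) (List.map-tabulate id suc) ⟩
  take h (tabulate suc)                                ∎)
  where open ≡-Reasoning

toList≡map-lookup : (w : Vec A n) → toList w ≡ map (lookup w) (allFin n)
toList≡map-lookup Vec.[]        = refl
toList≡map-lookup {n = suc n} (x Vec.∷ w) = cong (x ∷_) (trans (toList≡map-lookup w)
  (trans (List.map-tabulate id (lookup w)) (sym (List.map-tabulate suc (lookup (x Vec.∷ w))))))

take-toList : ∀ h (w : Perm n) → take h (toList w) ≡ map (lookup w) (tops n h)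
take-toList {n} h w = begin
  take h (toList w)                     ≡⟨ cong (take h) (toList≡map-lookup w) ⟩
  take h (map (lookup w) (allFin n))    ≡⟨ List.take-map h (allFin n) ⟩
  map (lookup w) (take h (allFin n))    ≡⟨ cong (map (lookup w)) (sym (tops≡take n h)) ⟩
  map (lookup w) (tops n h)             ∎
  where open ≡-Reasoning

length-tops : ∀ n h → h ≤ n → length (tops n h) ≡ h
length-tops n h h≤n = begin
  length (tops n h)             ≡⟨ cong length (tops≡take n h) ⟩
  length (take h (allFin n))    ≡⟨ List.length-take h (allFin n) ⟩
  h ⊓ length (allFin n)         ≡⟨ cong (h ⊓_) (List.length-tabulate {n = n} id) ⟩
  h ⊓ n                         ≡⟨ ℕ.m≤n⇒m⊓n≡m h≤n ⟩
  h                             ∎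
  where open ≡-Reasoning

-- `Γk h` unfolds to `rows` over `tops n h` with columns `bottoms n h`, so the results on rows apply
-- directly.
Γk-positive : ∀ n h → All Positive (Γk {n} h)
Γk-positive n h = rows-positive (bottoms-Down n h) ∈-bottoms (tops-Up n h)

Γk-unique : ∀ h {w x u : Perm n} {J K} → IsPerm u → Path w (Γk h) J u → Path x (Γk h) K u →
  take h (toList w) ↭ take h (toList x) → w ≡ x × J ≡ K
Γk-unique {n} h {w} {x} u-perm path path′ perm =
  rows-unique (bottoms-Down n h) ∈-bottoms (tops-Up n h) u-perm path path′ (subst₂ _↭_ (take-toList h w) (take-toList h x) perm)

Γk-exists : ∀ h (u : Perm n) (S : List (Fin n)) → IsPerm u → Unique S → length S ≡ h → h ≤ n →
  ∃₂ λ w J → Path w (Γk h) J u × take h (toList w) ↭ S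
Γk-exists {n} h u S u-perm uniq len h≤n
  -- Disjointness is vacuous at the start: every position below `h` is one of the rows.
  with w , J , path , perm ← rows-exists (bottoms-Down n h) ∈-bottoms u S (tops-Up n h) u-perm uniq
         (trans len (sym (length-tops n h h≤n))) (λ i∉ i<h → ⊥-elim (i∉ (∈-tops i<h)))
  = w , J , path , subst (_↭ S) (sym (take-toList h w)) perm

-- Sorted columns and the bijection

module _ {n : ℕ} where
  open Data.List.Sort (Fin.≤-decTotalOrder n) public using (sort; sort-↭; sort-↗)

-- Turns equality of sorted columns into the hypothesis of `Γk-unique`.
sort-injective : {xs ys : List (Fin n)} → sort xs ≡ sort ys → xs ↭ ys
sort-injective {xs = xs} {ys} eq = ↭-trans (↭-sym (sort-↭ xs)) (↭-trans (↭-reflexive eq) (sort-↭ ys))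

sort-strict : {xs : List (Fin n)} → Unique xs → Linked Fin._<_ (sort xs)
sort-strict {n} {xs} uniq = Linked.AllPairs⇒Linked (AllPairs.zipWith (λ (x≤y , x≢y) → Fin.≤∧≢⇒< x≤y x≢y)
  (Sorted⇒AllPairs (DecTotalOrder.totalOrder (Fin.≤-decTotalOrder n)) (sort-↗ xs) , Unique-resp-↭ (↭-sym (sort-↭ xs)) uniq))

sort-unique : {xs ys : List (Fin n)} → xs ↭ ys → Linked Fin._<_ ys → sort xs ≡ ys
sort-unique {n} {xs} {ys} xs↭ys ys↗ = Pointwise-≡⇒≡ (↗↭↗⇒≋ (DecTotalOrder.totalOrder (Fin.≤-decTotalOrder n))
  (sort-↗ xs) (Linked.map ℕ.<⇒≤ ys↗) (↭⇒↭ₛ (↭-trans (sort-↭ xs) xs↭ys)))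

strict⇒Unique : {xs : List (Fin n)} → Linked Fin._<_ xs → Unique xs
strict⇒Unique xs↗ = AllPairs.map Fin.<⇒≢ (Linked.Linked⇒AllPairs Fin.<-trans xs↗)

Path-length : ∀ {w u : Perm n} {βs J} → Path w βs J u → length J ≡ length βs
Path-length done          = refl
Path-length (skip path)   = cong suc (Path-length path)
Path-length (fold _ path) = cong suc (Path-length path)

applyT-Path : ∀ {w u : Perm n} {βs J} → Path w βs J u → applyT w βs J ≡ u
applyT-Path done          = refl
applyT-Path (skip path)   = applyT-Path path
applyT-Path (fold _ path) = applyT-Path path

applyT-isPerm : ∀ (w : Perm n) {βs} J → All Positive βs → IsPerm w → IsPerm (applyT w βs J)
applyT-isPerm w J           []           w-perm = w-perm
applyT-isPerm w []          (_ ∷ _)      w-perm = w-perm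
applyT-isPerm w (true ∷ J)  (a<b ∷ βs>0) w-perm = applyT-isPerm _ J βs>0 (swap-isPerm w (Fin.<⇒≢ a<b) w-perm)
applyT-isPerm w (false ∷ J) (_ ∷ βs>0)   w-perm = applyT-isPerm w J βs>0 w-perm

take-++-length : ∀ (xs {ys} : List A) {k} → length xs ≡ k → take k (xs ++ ys) ≡ xs
take-++-length []       refl = refl
take-++-length (x ∷ xs) refl = cong (x ∷_) (take-++-length xs refl)

drop-++-length : ∀ (xs {ys} : List A) {k} → length xs ≡ k → drop k (xs ++ ys) ≡ ys
drop-++-length []       refl = refl
drop-++-length (x ∷ xs) refl = drop-++-length xs refl

-- The shape is generalised to an arbitrary list of column heights to allow induction on blocks.
blocksOf : (n : ℕ) → List ℕ → List (ℕ × List (Root n))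
blocksOf n = map (λ h → (h , Γk h))

Γof : (n : ℕ) → List ℕ → List (Root n)
Γof n hs = concat (map proj₂ (blocksOf n hs))

Γof-positive : ∀ n hs → All Positive (Γof n hs)
Γof-positive n []       = []
Γof-positive n (h ∷ hs) = All.++⁺ (Γk-positive n h) (Γof-positive n hs)

-- The length of a path cuts the choices at the block boundary, and `applyT` retraces the path to
-- `v`.
fillBlocks-∷ : ∀ h hs {w v : Perm n} {J} K → Path w (Γk h) J v →
  fillBlocks w (blocksOf n (h ∷ hs)) (J ++ K) ≡ take h (toList w) ∷ fillBlocks v (blocksOf n hs) K
fillBlocks-∷ h hs {w} {v} {J} K path
  rewrite take-++-length J {K} (Path-length path) | drop-++-length J {K} (Path-length path) | applyT-Path path = refl

-- Induction backwards from the common end: the later columns determine the later blocks and hence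
-- where the first block ends; the first column then determines that block.
blocks-unique : ∀ hs {w x : Perm n} {J K} → Path w (Γof n hs) J idPerm → Path x (Γof n hs) K idPerm →
  ord (fillBlocks w (blocksOf n hs) J) ≡ ord (fillBlocks x (blocksOf n hs) K) → w ≡ x × J ≡ K
blocks-unique [] done done _ = refl , refl
blocks-unique {n} (h ∷ hs) {w} {x} path path′ eq
  with v , J₁ , J₂ , refl , path₁ , path₂ ← Path-++⁻ (Γk h) path
  with y , K₁ , K₂ , refl , path₁′ , path₂′ ← Path-++⁻ (Γk h) path′
  with eq′ ← trans (cong ord (sym (fillBlocks-∷ h hs J₂ path₁))) (trans eq (cong ord (fillBlocks-∷ h hs K₂ path₁′)))
  with refl , refl ← blocks-unique hs path₂ path₂′ (List.∷-injectiveʳ eq′)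
  with refl , refl ← Γk-unique h {w} {x} (Path-isPerm {w = v} (Γof-positive n hs) path₂ idPerm-isPerm) path₁ path₁′
                       (sort-injective (List.∷-injectiveˡ eq′))
  = refl , refl

-- Blocks are built from last to first; the start of the later blocks is the end prescribed for the
-- block before them.
blocks-exists : ∀ hs (F : List (List (Fin n))) → All (_≤ n) hs → map length F ≡ hs → All (Linked Fin._<_) F →
  ∃₂ λ w J → Path w (Γof n hs) J idPerm × ord (fillBlocks w (blocksOf n hs) J) ≡ F
blocks-exists [] [] _ _ _ = idPerm , [] , done , refl
blocks-exists {n} (h ∷ hs) (C ∷ F) (h≤n ∷ hs≤n) lengths (C↗ ∷ F↗)
  with v , K , path₂ , eq ← blocks-exists hs F hs≤n (List.∷-injectiveʳ lengths) F↗
  with w , J , path₁ , perm ← Γk-exists h v C (Path-isPerm {w = v} (Γof-positive n hs) path₂ idPerm-isPerm)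
                                (strict⇒Unique C↗) (List.∷-injectiveˡ lengths) h≤n
  = w , J ++ K , Path-++⁺ path₁ path₂ ,
    trans (cong ord (fillBlocks-∷ h hs K path₁)) (cong₂ _∷_ (sort-unique perm C↗) eq)

length-column : ∀ h (w : Perm n) → h ≤ n → length (take h (toList w)) ≡ h
length-column {n} h w h≤n = trans (cong length (take-toList h w)) (trans (List.length-map (lookup w) (tops n h)) (length-tops n h h≤n))

column-Unique : ∀ h (w : Perm n) → IsPerm w → Unique (take h (toList w))
column-Unique {n} h w w-perm = subst Unique (sym (take-toList h w))
  (Unique.map⁺ (λ {i} {j} → w-perm i j) (Unique.filter⁺ (λ a → toℕ a <? h) (Unique.allFin⁺ n)))

ord-fillBlocks-lengths : ∀ hs (w : Perm n) J → All (_≤ n) hs → map length (ord (fillBlocks w (blocksOf n hs) J)) ≡ hs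
ord-fillBlocks-lengths [] w J _ = refl
ord-fillBlocks-lengths (h ∷ hs) w J (h≤n ∷ hs≤n) = cong₂ _∷_
  (trans (↭-length (sort-↭ (take h (toList w)))) (length-column h w h≤n)) (ord-fillBlocks-lengths hs _ _ hs≤n)

ord-fillBlocks-strict : ∀ hs (w : Perm n) J → IsPerm w → All (Linked Fin._<_) (ord (fillBlocks w (blocksOf n hs) J))
ord-fillBlocks-strict [] w J _ = []
ord-fillBlocks-strict {n} (h ∷ hs) w J w-perm = sort-strict (column-Unique h w w-perm) ∷
  ord-fillBlocks-strict hs _ _ (applyT-isPerm w (take (length (Γk {n} h)) J) (Γk-positive n h) w-perm)

shape≤n : (μ : Vec ℕ n) → All (_≤ n) (shape μ)
shape≤n μ = All.map⁺ (All.tabulate {xs = downFrom (first μ)} λ {j} _ →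
  ℕ.≤-trans (List.length-filter (λ x → suc j ≤? x) (toList μ)) (ℕ.≤-reflexive (Vec.length-toList μ)))

InFbar⇒Path : (μ : Vec ℕ n) {w : Perm n} {J : List Bool} → InFbar μ w J → Path w (Γ μ) J idPerm
InFbar⇒Path {n} μ (w-perm , _ , _ , _ , run , eq) = exact⇒Path (Γof-positive n (shape μ)) w-perm run eq

theorem4p1 : (n : ℕ) → 2 ≤ n → (μ : Vec ℕ n) → IsPartition μ →
    ((w : Perm n) (J : List Bool) → InFbar μ w J → InB μ (ord (fill μ w J)))
    × ((w₁ w₂ : Perm n) (J₁ J₂ : List Bool) → InFbar μ w₁ J₁ → InFbar μ w₂ J₂ →
    ord (fill μ w₁ J₁) ≡ ord (fill μ w₂ J₂) → (w₁ ≡ w₂) × (J₁ ≡ J₂))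
    × ((F : List (List (Fin n))) → InB μ F →
    ∃₂ λ (w : Perm n) (J : List Bool) → InFbar μ w J × (ord (fill μ w J) ≡ F))
theorem4p1 n _ μ _ = into , injective , onto
  where
  into : (w : Perm n) (J : List Bool) → InFbar μ w J → InB μ (ord (fill μ w J))
  into w J (w-perm , _) = ord-fillBlocks-lengths (shape μ) w J (shape≤n μ) , ord-fillBlocks-strict (shape μ) w J w-perm
  injective : (w₁ w₂ : Perm n) (J₁ J₂ : List Bool) → InFbar μ w₁ J₁ → InFbar μ w₂ J₂ →
    ord (fill μ w₁ J₁) ≡ ord (fill μ w₂ J₂) → (w₁ ≡ w₂) × (J₁ ≡ J₂)
  injective w₁ w₂ J₁ J₂ in₁ in₂ = blocks-unique (shape μ) (InFbar⇒Path μ {w₁} in₁) (InFbar⇒Path μ {w₂} in₂)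
  onto : (F : List (List (Fin n))) → InB μ F →
    ∃₂ λ (w : Perm n) (J : List Bool) → InFbar μ w J × (ord (fill μ w J) ≡ F)
  onto F (lengths , strict) with w , J , path , eq ← blocks-exists (shape μ) F (shape≤n μ) lengths strict =
    w , J , (w-perm , Path-length path , Path⇒exact (Γof-positive n (shape μ)) w-perm path) , eq
    where
    w-perm : IsPerm w
    w-perm = Path-isPerm {w = w} (Γof-positive n (shape μ)) path idPerm-isPerm
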